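{- Let $\Delta\ \mathsf{ctx_{Kan}}\,[\Psi]$. For any value $\Delta$-indexed $\Psi$-PER $\alpha$, $\psi:\Psi'\to\Psi$, $\overline I\in\Delta\psi\,[\Psi']$, dimension terms $r,r'$ over $\Psi'$, and valid list of constraints $\overline{\xi_i}$ over $\Psi'$, if (1) $\mathrm{Tm}(\alpha_\psi[\overline I])(M,M')$, (2) $\mathrm{Tm}(\alpha_\psi[\overline I])_{y\mid\xi_i,\xi_j}(N_i,N_j')$ for all $i,j$, (3) $\mathrm{Tm}(\alpha_\psi[\overline I])_{\mathrm{id}\mid\xi_i}(N_i\langle r/y\rangle,M)$ for all $i$, then (a) $\mathrm{Tm}(\alpha_\psi[\overline I])_{\mathrm{id}\mid\xi_i}(\mathsf{fhcom}^{r\rightsquigarrow r'}(M;\overline{\xi_i\hookrightarrow y.N_i}),\,N_i\langle r'/y\rangle)$ for all $i$, (b) $\mathrm{Tm}(\alpha_\psi[\overline I])_{\mathrm{id}\mid r=r'}(\mathsf{fhcom}^{r\rightsquigarrow r'}(M;\overline{\xi_i\hookrightarrow y.N_i}),\,M)$, (c) $\mathrm{Tm}((\alpha\cup\mathrm{Fhcom}(\alpha))_\psi[\overline I])(\mathsf{fhcom}^{r\rightsquigarrow r'}(M;\overline{\xi_i\hookrightarrow y.N_i}),\,\mathsf{fhcom}^{r\rightsquigarrow r'}(M';\overline{\xi_i\hookrightarrow y.N_i'}))$.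
   Context: \textbf{Programs.} Fix a cubical operational semantics: a grammar of terms with variable binding, possibly containing dimension terms, with judgments $V\ \mathsf{val}$ and deterministic $M\mapsto M'$ on terms without free term variables (values do not step); $M\Downarrow V$ means $M\mapsto^*V$ and $V\ \mathsf{val}$. A dimension term is $0$, $1$ or a dimension variable; a dimension context $\Psi$ is a finite list of dimension variables; a $\Psi$-term has its free dimension variables in $\Psi$. A substitution $\psi:\Psi'\to\Psi$ assigns to each $x\in\Psi$ a dimension term over $\Psi'$; $M\psi$ is the substituted term, $M(\psi\psi')=(M\psi)\psi'$, and $\langle r/x\rangle$ replaces $x$ by $r$. A constraint $\xi$ is a formal equation $r=r'$ of dimension terms; $\models\xi$ iff $r,r'$ are the same; $\models\Xi$ for a list $\Xi$ iff all members hold. $\Xi$ is valid if some member holds or, for some $r$, it contains both $r=0$ and $r=1$. Overlines denote finite lists; in $\overline{\xi_i\hookrightarrow y.N_i}$ the variable $y$ is bound in $N_i$. \textbf{$\Psi$-relations.} A $\Psi$-relation $\alpha$ gives, for each $\psi:\Psi'\to\Psi$, a binary relation $\alpha_\psi$ on $\Psi'$-terms without free term variables. It is a value relation if it relates only values, a $\Psi$-PER if all $\alpha_\psi$ are symmetric and transitive. $\alpha(M,M')$ means $\alpha_{\mathrm{id}}(M,M')$; $(\alpha\psi)_{\psi'}=\alpha_{\psi\psi'}$; $\alpha_\psi\{M_1,\dots,M_n\}$ means $\alpha_\psi(M_i,M_j)$ for all $i,j$. $\alpha_{\psi\mid\Xi}(M,M')$ means $\alpha_{\psi\psi'}(M\psi',M'\psi')$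 for all $\psi'$ into the domain of $\psi$ with $\models\Xi\psi'$; for a $\Psi'$-relation $\beta$ and $(\Psi',y)$-terms $N,N'$, $\beta_{y\mid\Xi}(N,N')$ means $\beta_{\pi\mid\Xi}(N,N')$ with $\pi:(\Psi',y)\to\Psi'$ the weakening. For a value $\Psi$-relation $\alpha$, $\mathrm{Tm}(\alpha)_\psi(M,M')$ holds (for $\psi:\Psi'\to\Psi$) iff for all $\psi_1:\Psi_1\to\Psi'$, $\psi_2:\Psi_2\to\Psi_1$ there are terms with $M\psi_1\Downarrow M_1$, $M_1\psi_2\Downarrow M_2$, $M\psi_1\psi_2\Downarrow M_{12}$, $M'\psi_1\Downarrow M_1'$, $M_1'\psi_2\Downarrow M_2'$, $M'\psi_1\psi_2\Downarrow M_{12}'$ and, for $\chi=\psi\psi_1\psi_2$, $\alpha_\chi(M_2,M_2')$, $\alpha_\chi\{M_2,M_{12}\}$, $\alpha_\chi\{M_2',M'_{12}\}$. $\alpha$ is value-coherent if $\alpha_\psi(V,V')$ implies $\mathrm{Tm}(\alpha)_\psi(V,V')$. \textbf{Index contexts.} A candidate cubical type system $\tau(\Psi,A_0,A_0',\varphi)$ (relating $\Psi$-term values $A_0,A_0'$ and a relation $\varphi$ on $\Psi$-term values) is fixed. $\mathrm{PTy}(\tau)(\Psi,A,A',\alpha)$, for a value $\Psi$-relation $\alpha$, holds iff for all $\psi_1:\Psi_1\to\Psi,\psi_2:\Psi_2\to\Psi_1$ there are $A\psi_1\Downarrow A_1$, $A_1\psi_2\Downarrow A_2$, $A\psi_1\psi_2\Downarrow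 A_{12}$ and likewise $A'_1,A_2',A_{12}'$ from $A'$ with $\tau(\Psi_2,B,B',\alpha_{\psi_1\psi_2})$ for $(B,B')=(A_2,A_2')$, for all $B,B'\in\{A_2,A_{12}\}$, and for all $B,B'\in\{A_2',A_{12}'\}$. $\tau$ is a cubical type system: $\varphi$ is determined by $(\Psi,A,A')$ and is a PER, each $\tau(\Psi,-,-,\varphi)$ is a PER, and $\tau(\Psi,A,A',\varphi)$ implies $\mathrm{PTy}(\tau)(\Psi,A,A',\alpha)$ for some $\alpha$. $A\doteq A'\ \mathsf{type_{pre}}\,[\Psi]$ iff $\mathrm{PTy}(\tau)(\Psi,A,A',\alpha)$ with $\alpha$ value-coherent (written $[\![A]\!]$); $M\doteq M'\in A\,[\Psi]$ iff $\mathrm{Tm}([\![A]\!])(M,M')$; unary forms are reflexive instances. Contexts (telescopes) $\Delta$, lists $\overline I\doteq\overline I'\in\Delta$, and open judgments are defined by functionality: an open judgment holds iff all its instances under dimension substitutions and equal closing lists hold. $\mathsf{ctx_{Kan}}$ requires the types to be Kan, i.e. closed under the composition operator $\mathsf{hcom}$ and the coercion operator $\mathsf{coe}$: $A\doteq A'$ are Kan if, with $\alpha=[\![A]\!]$, (hcom) for all $\psi:\Psi'\to\Psi$, $r,r'$, valid $\overline{\xi_i}$, $\mathrm{Tm}(\alpha)_\psi(M,M')$, $N_i,N_j'$ related in $\mathrm{Tm}(\alpha)_{\psi\pi\mid\xi_i,\xi_j}$ and $\mathrm{Tm}(\alpha)_{\psi\mid\xi_i}(N_i\langle r/y\rangle,M)$,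 the terms $H^{r'}=\mathsf{hcom}_{A\psi}^{r\rightsquigarrow r'}(M;\overline{\xi_i\hookrightarrow y.N_i})$ and $\mathsf{hcom}_{A'\psi}^{r\rightsquigarrow r'}(M';\overline{\xi_i\hookrightarrow y.N'_i})$ are related in $\mathrm{Tm}(\alpha)_\psi$, as are $H^r$ and $M$, and $\mathrm{Tm}(\alpha)_{\psi\mid\xi_i}(H^{r'},N_i\langle r'/y\rangle)$; (coe) for all $\psi:(\Psi',y)\to\Psi$, $r,r'$, $\mathrm{Tm}(\alpha)_{\psi\langle r/y\rangle}(M,M')$ implies $\mathrm{Tm}(\alpha)_{\psi\langle r'/y\rangle}(\mathsf{coe}_{y.A\psi}^{r\rightsquigarrow r'}(M),\mathsf{coe}_{y.A'\psi}^{r\rightsquigarrow r'}(M'))$ and $\mathrm{Tm}(\alpha)_{\psi\langle r/y\rangle}(\mathsf{coe}_{y.A\psi}^{r\rightsquigarrow r}(M),M)$. \textbf{Indexed relations.} A $\Delta$-indexed $\Psi$-relation $\alpha$ gives a $\Psi'$-relation $\alpha_\psi[\overline I]$ for each $\psi:\Psi'\to\Psi$ and $\overline I\in\Delta\psi\,[\Psi']$, with $\alpha_\psi[\overline I]\psi'=\alpha_{\psi\psi'}[\overline I\psi']$ and $\alpha_\psi[\overline I]=\alpha_\psi[\overline I']$ when $\overline I\doteq\overline I'\in\Delta\psi$; it is determined by identity components. It is a value relation or PER if all $\alpha_\psi[\overline I]$ are. Unions are componentwise. \textbf{fhcom.} $\mathsf{fhcom}^{r\rightsquigarrow r'}(M;\overline{\xi_i\hookrightarrow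 y.N_i})$ steps to $N_i\langle r'/y\rangle$ for the least $i$ with $\models\xi_i$ if any; otherwise to $M$ if $r=r'$; otherwise it is a value. $\mathrm{Fhcom}(\alpha)$ is the value $\Delta$-indexed $\Psi$-relation whose identity component at $\psi,\overline I$ relates $\mathsf{fhcom}^{r\rightsquigarrow r'}(M;\overline{\xi_i\hookrightarrow y.N_i})$ and $\mathsf{fhcom}^{r\rightsquigarrow r'}(M';\overline{\xi_i\hookrightarrow y.N'_i})$ whenever $\overline{\xi_i}$ is valid, no $\xi_i$ holds, $r\ne r'$, $\mathrm{Tm}(\alpha_\psi[\overline I])(M,M')$, $\mathrm{Tm}(\alpha_\psi[\overline I])_{y\mid\xi_i,\xi_j}(N_i,N_j')$ and $\mathrm{Tm}(\alpha_\psi[\overline I])_{\mathrm{id}\mid\xi_i}(N_i\langle r/y\rangle,M)$ for all $i,j$. -}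

module Defs where

open import Level using (Level; _⊔_; 0ℓ) renaming (suc to lsuc)
open import Data.Nat.Base using (ℕ; zero; suc; _+_)
open import Data.Fin.Base using (Fin; zero; suc; _↑ʳ_; _<_)
open import Data.List.Base as List using (List; []; _∷_)
open import Data.List.Relation.Unary.All using (All; []; _∷_)
open import Data.Product.Base using (Σ-syntax; ∃-syntax; _×_; _,_)
open import Data.Sum.Base using (_⊎_; inj₁; inj₂)
import Data.Sum.Function.Propositional as Sum
open import Data.Unit.Polymorphic.Base using (⊤)
open import Data.Vec.Base as Vec using (Vec; []; _∷_; lookup; tabulate)
open import Data.Vec.Membership.Propositional using (_∈_)
open import Data.Vec.Properties using (map-∘; map-cong; lookup-map)
open import Data.Vec.Relation.Unary.Any using (Any)
open import Function.Base using (_∘_)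
open import Function.Bundles using (_⇔_; mk⇔; Equivalence)
open import Function.Properties.Equivalence using () renaming (trans to ⇔-trans)
open import Relation.Binary.Construct.Closure.ReflexiveTransitive using (Star)
open import Relation.Binary.Core using (Rel)
open import Relation.Binary.PropositionalEquality using (_≡_; _≢_; refl; sym; trans; cong; subst)
open import Relation.Binary.Structures using (IsPartialEquivalence)
open import Relation.Nullary.Negation using (¬_)

-- A dimension context is its length; variables are de
-- Bruijn indices, 0 being the most recently added.

data Dim (Ψ : ℕ) : Set where
  𝟎 𝟏 : Dim Ψ
  var : Fin Ψ → Dim Ψ

infix 3 _⇒_
_⇒_ : ℕ → ℕ → Set
Ψ' ⇒ Ψ = Vec (Dim Ψ') Ψ

infixl 9 _[_]ᵈ _[_]ᶜ
_[_]ᵈ : ∀ {Ψ Ψ'} → Dim Ψ → Ψ' ⇒ Ψ → Dim Ψ'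
𝟎     [ ψ ]ᵈ = 𝟎
𝟏     [ ψ ]ᵈ = 𝟏
var x [ ψ ]ᵈ = lookup ψ x

-- Diagrammatic with respect to action on terms: M (ψ ψ') = (M ψ) ψ'.
infixl 8 _⊙_
_⊙_ : ∀ {Ψ Ψ' Ψ''} → Ψ' ⇒ Ψ → Ψ'' ⇒ Ψ' → Ψ'' ⇒ Ψ
ψ ⊙ ψ' = Vec.map (_[ ψ' ]ᵈ) ψ

idᵈ : ∀ {Ψ} → Ψ ⇒ Ψ
idᵈ = tabulate var

πₙ : ∀ {Ψ} k → k + Ψ ⇒ Ψ
πₙ k = tabulate (var ∘ (k ↑ʳ_))

π : ∀ {Ψ} → suc Ψ ⇒ Ψ
π = πₙ 1

-- ⟨r/y⟩ for the most recent variable y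
⟨_/y⟩ : ∀ {Ψ} → Dim Ψ → Ψ ⇒ suc Ψ
⟨ r /y⟩ = r ∷ idᵈ

liftᵈ : ∀ {Ψ Ψ'} k → Ψ' ⇒ Ψ → k + Ψ' ⇒ k + Ψ
liftᵈ zero      ψ = ψ
liftᵈ (suc k) ψ = var zero ∷ (liftᵈ k ψ ⊙ π)

[]ᵈ-⊙ : ∀ {Ψ Ψ' Ψ''} (r : Dim Ψ) (ψ : Ψ' ⇒ Ψ) (ψ' : Ψ'' ⇒ Ψ') →
        r [ ψ ⊙ ψ' ]ᵈ ≡ r [ ψ ]ᵈ [ ψ' ]ᵈ
[]ᵈ-⊙ 𝟎       ψ ψ' = refl
[]ᵈ-⊙ 𝟏       ψ ψ' = refl
[]ᵈ-⊙ (var x) ψ ψ' = lookup-map x (_[ ψ' ]ᵈ) ψ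

⊙-assoc : ∀ {Ψ Ψ' Ψ'' Ψ'''} (ψ : Ψ' ⇒ Ψ) (ψ' : Ψ'' ⇒ Ψ') (ψ'' : Ψ''' ⇒ Ψ'') →
          ψ ⊙ ψ' ⊙ ψ'' ≡ ψ ⊙ (ψ' ⊙ ψ'')
⊙-assoc ψ ψ' ψ'' =
  trans (sym (map-∘ (_[ ψ'' ]ᵈ) (_[ ψ' ]ᵈ) ψ))
        (map-cong (λ r → sym ([]ᵈ-⊙ r ψ' ψ'')) ψ)

infix 5 _＝_
record Constraint (Ψ : ℕ) : Set where
  constructor _＝_
  field lhs rhs : Dim Ψ

_[_]ᶜ : ∀ {Ψ Ψ'} → Constraint Ψ → Ψ' ⇒ Ψ → Constraint Ψ'
(r ＝ r') [ ψ ]ᶜ = r [ ψ ]ᵈ ＝ r' [ ψ ]ᵈ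

infix 4 ⊨_
⊨_ : ∀ {Ψ} → Constraint Ψ → Set
⊨ (r ＝ r') = r ≡ r'

Valid : ∀ {Ψ n} → Vec (Constraint Ψ) n → Set
Valid {Ψ} ξs = Any ⊨_ ξs ⊎ (∃[ r ] ((r ＝ 𝟎) ∈ ξs × (r ＝ 𝟏) ∈ ξs))

-- Terms over an arbitrary second-order binding signature.  Besides its
-- term arguments, each binding some numbers of dimension and of term
-- variables, an operator may take dimension arguments.  The operators
-- hcom, coe and fhcom, to which the theory refers, are built in; each tube
-- N i binds one dimension variable.

record Signature : Set₁ where
  field
    Op   : Set
    dims : Op → ℕ
    args : Op → List (ℕ × ℕ)

module _ (S : Signature) where
  open Signature S

  -- Dimension variables in Ψ, term variables in Γ.
  data Term (Ψ Γ : ℕ) : Set where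
    var   : Fin Γ → Term Ψ Γ
    op    : (o : Op) → Vec (Dim Ψ) (dims o) →
            All (λ (k , m) → Term (k + Ψ) (m + Γ)) (args o) → Term Ψ Γ
    hcom  : ∀ {n} → Term Ψ Γ → Dim Ψ → Dim Ψ → Term Ψ Γ →
            Vec (Constraint Ψ) n → Vec (Term (suc Ψ) Γ) n → Term Ψ Γ
    coe   : Term (suc Ψ) Γ → Dim Ψ → Dim Ψ → Term Ψ Γ → Term Ψ Γ
    fhcom : ∀ {n} → Dim Ψ → Dim Ψ → Term Ψ Γ →
            Vec (Constraint Ψ) n → Vec (Term (suc Ψ) Γ) n → Term Ψ Γ

module _ {S : Signature} where

  private
    Args : ℕ → ℕ → List (ℕ × ℕ) → Set
    Args Ψ Γ = All (λ (k , m) → Term S (k + Ψ) (m + Γ))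

  infixl 9 _[_]
  mutual
    _[_] : ∀ {Ψ Ψ' Γ} → Term S Ψ Γ → Ψ' ⇒ Ψ → Term S Ψ' Γ
    var a             [ ψ ] = var a
    op o rs as        [ ψ ] = op o (rs ⊙ ψ) (dsubArgs as ψ)
    hcom A r r' M ξs Ns [ ψ ] =
      hcom (A [ ψ ]) (r [ ψ ]ᵈ) (r' [ ψ ]ᵈ) (M [ ψ ]) (Vec.map (_[ ψ ]ᶜ) ξs) (dsubs Ns (liftᵈ 1 ψ))
    coe A r r' M      [ ψ ] = coe (A [ liftᵈ 1 ψ ]) (r [ ψ ]ᵈ) (r' [ ψ ]ᵈ) (M [ ψ ])
    fhcom r r' M ξs Ns [ ψ ] =
      fhcom (r [ ψ ]ᵈ) (r' [ ψ ]ᵈ) (M [ ψ ]) (Vec.map (_[ ψ ]ᶜ) ξs) (dsubs Ns (liftᵈ 1 ψ))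

    dsubArgs : ∀ {Ψ Ψ' Γ as} → Args Ψ Γ as → Ψ' ⇒ Ψ → Args Ψ' Γ as
    dsubArgs []                    ψ = []
    dsubArgs (_∷_ {x = k , m} M Ms) ψ = M [ liftᵈ k ψ ] ∷ dsubArgs Ms ψ

    dsubs : ∀ {Ψ Ψ' Γ n} → Vec (Term S Ψ Γ) n → Ψ' ⇒ Ψ → Vec (Term S Ψ' Γ) n
    dsubs []       ψ = []
    dsubs (M ∷ Ms) ψ = M [ ψ ] ∷ dsubs Ms ψ

  liftʳ : ∀ {Γ Γ'} m → Vec (Fin Γ') Γ → Vec (Fin (m + Γ')) (m + Γ)
  liftʳ zero      ρ = ρ
  liftʳ (suc m) ρ = zero ∷ Vec.map suc (liftʳ m ρ)

  mutual
    rename : ∀ {Ψ Γ Γ'} → Vec (Fin Γ') Γ → Term S Ψ Γ → Term S Ψ Γ'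
    rename ρ (var a)              = var (lookup ρ a)
    rename ρ (op o rs as)         = op o rs (renameArgs ρ as)
    rename ρ (hcom A r r' M ξs Ns) = hcom (rename ρ A) r r' (rename ρ M) ξs (renames ρ Ns)
    rename ρ (coe A r r' M)       = coe (rename ρ A) r r' (rename ρ M)
    rename ρ (fhcom r r' M ξs Ns) = fhcom r r' (rename ρ M) ξs (renames ρ Ns)

    renameArgs : ∀ {Ψ Γ Γ' as} → Vec (Fin Γ') Γ → Args Ψ Γ as → Args Ψ Γ' as
    renameArgs ρ []                     = []
    renameArgs ρ (_∷_ {x = k , m} M Ms) = rename (liftʳ m ρ) M ∷ renameArgs ρ Ms

    renames : ∀ {Ψ Γ Γ' n} → Vec (Fin Γ') Γ → Vec (Term S Ψ Γ) n → Vec (Term S Ψ Γ') n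
    renames ρ []       = []
    renames ρ (M ∷ Ms) = rename ρ M ∷ renames ρ Ms

  liftˢ : ∀ {Ψ Γ Γ'} m → Vec (Term S Ψ Γ') Γ → Vec (Term S Ψ (m + Γ')) (m + Γ)
  liftˢ zero      σ = σ
  liftˢ (suc m) σ = var zero ∷ renames (tabulate suc) (liftˢ m σ)

  -- Simultaneous substitution for term variables.
  infixl 9 _⟦_⟧
  mutual
    _⟦_⟧ : ∀ {Ψ Γ Γ'} → Term S Ψ Γ → Vec (Term S Ψ Γ') Γ → Term S Ψ Γ'
    var a              ⟦ σ ⟧ = lookup σ a
    op o rs as         ⟦ σ ⟧ = op o rs (subArgs as σ)
    hcom A r r' M ξs Ns ⟦ σ ⟧ = hcom (A ⟦ σ ⟧) r r' (M ⟦ σ ⟧) ξs (subs Ns (dsubs σ π))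
    coe A r r' M       ⟦ σ ⟧ = coe (A ⟦ dsubs σ π ⟧) r r' (M ⟦ σ ⟧)
    fhcom r r' M ξs Ns ⟦ σ ⟧ = fhcom r r' (M ⟦ σ ⟧) ξs (subs Ns (dsubs σ π))

    subArgs : ∀ {Ψ Γ Γ' as} → Args Ψ Γ as → Vec (Term S Ψ Γ') Γ → Args Ψ Γ' as
    subArgs []                     σ = []
    subArgs (_∷_ {x = k , m} M Ms) σ = M ⟦ liftˢ m (dsubs σ (πₙ k)) ⟧ ∷ subArgs Ms σ

    subs : ∀ {Ψ Γ Γ' n} → Vec (Term S Ψ Γ) n → Vec (Term S Ψ Γ') Γ → Vec (Term S Ψ Γ') n
    subs []       σ = []
    subs (M ∷ Ms) σ = M ⟦ σ ⟧ ∷ subs Ms σ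

-- Of the built-in operators, only the behaviour of fhcom is prescribed.
-- The judgments at different dimension contexts need not be related.

record OpSem (S : Signature) : Set₁ where
  infix 4 _↦_
  field
    Val  : ∀ {Ψ} → Term S Ψ 0 → Set
    _↦_  : ∀ {Ψ} → Rel (Term S Ψ 0) 0ℓ
    ↦-deterministic : ∀ {Ψ} {M M' M'' : Term S Ψ 0} → M ↦ M' → M ↦ M'' → M' ≡ M''
    Val-↦ : ∀ {Ψ} {V M : Term S Ψ 0} → Val V → ¬ (V ↦ M)

    fhcom-tube : ∀ {Ψ n} {r r' : Dim Ψ} {M : Term S Ψ 0}
                 {ξs : Vec (Constraint Ψ) n} {Ns : Vec (Term S (suc Ψ) 0) n} (i : Fin n) →
                 ⊨ lookup ξs i → (∀ j → j < i → ¬ (⊨ lookup ξs j)) →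
                 fhcom r r' M ξs Ns ↦ lookup Ns i [ ⟨ r' /y⟩ ]
    fhcom-cap  : ∀ {Ψ n} {r r' : Dim Ψ} {M : Term S Ψ 0}
                 {ξs : Vec (Constraint Ψ) n} {Ns : Vec (Term S (suc Ψ) 0) n} →
                 (∀ i → ¬ (⊨ lookup ξs i)) → r ≡ r' → fhcom r r' M ξs Ns ↦ M
    fhcom-Val  : ∀ {Ψ n} {r r' : Dim Ψ} {M : Term S Ψ 0}
                 {ξs : Vec (Constraint Ψ) n} {Ns : Vec (Term S (suc Ψ) 0) n} →
                 (∀ i → ¬ (⊨ lookup ξs i)) → r ≢ r' → Val (fhcom r r' M ξs Ns)

  infix 4 _⇓_
  _⇓_ : ∀ {Ψ} → Rel (Term S Ψ 0) 0ℓ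
  M ⇓ V = Star _↦_ M V × Val V

-- R ⟪ X₁ ∷ … ∷ Xₙ ∷ [] ⟫ relates every two of the Xᵢ.
_⟪_⟫ : ∀ {a ℓ} {X : Set a} {n} → Rel X ℓ → Vec X n → Set ℓ
R ⟪ Xs ⟫ = ∀ i j → R (lookup Xs i) (lookup Xs j)

-- A Ψ-relation; α ＠ ψ is the component written α_ψ.
record DRel (S : Signature) (ℓ : Level) (Ψ : ℕ) : Set (lsuc ℓ) where
  infix 7 _＠_
  field
    _＠_ : ∀ {Ψ'} → Ψ' ⇒ Ψ → Rel (Term S Ψ' 0) ℓ
open DRel public

module _ {S : Signature} where

  infix 4 _≋_
  _≋_ : ∀ {ℓ Ψ} → DRel S ℓ Ψ → DRel S ℓ Ψ → Set ℓ
  _≋_ {Ψ = Ψ} α β = ∀ {Ψ'} (ψ : Ψ' ⇒ Ψ) M M' → (α ＠ ψ) M M' ⇔ (β ＠ ψ) M M'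

  -- (α ψ)_ψ' = α_(ψ ψ')
  infixl 8 _·_
  _·_ : ∀ {ℓ Ψ Ψ'} → DRel S ℓ Ψ → Ψ' ⇒ Ψ → DRel S ℓ Ψ'
  α · ψ = record { _＠_ = λ ψ' → α ＠ (ψ ⊙ ψ') }

  infixr 6 _∪_
  _∪_ : ∀ {ℓ Ψ} → DRel S ℓ Ψ → DRel S ℓ Ψ → DRel S ℓ Ψ
  α ∪ β = record { _＠_ = λ ψ M M' → (α ＠ ψ) M M' ⊎ (β ＠ ψ) M M' }

  IsPER : ∀ {ℓ Ψ} → DRel S ℓ Ψ → Set ℓ
  IsPER {Ψ = Ψ} α = ∀ {Ψ'} (ψ : Ψ' ⇒ Ψ) → IsPartialEquivalence (α ＠ ψ)

  -- α_(ψ ∣ Ξ)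
  infix 7 _＠_∣_
  _＠_∣_ : ∀ {ℓ Ψ Ψ'} → DRel S ℓ Ψ → Ψ' ⇒ Ψ → List (Constraint Ψ') → Rel (Term S Ψ' 0) ℓ
  _＠_∣_ {Ψ' = Ψ'} α ψ Ξ M M' =
    ∀ {Ψ''} (ψ' : Ψ'' ⇒ Ψ') → All (λ ξ → ⊨ ξ [ ψ' ]ᶜ) Ξ → (α ＠ (ψ ⊙ ψ')) (M [ ψ' ]) (M' [ ψ' ])

  -- β_(y ∣ Ξ); the constraints, given over Ψ, are weakened by y.
  infix 7 _＠y∣_
  _＠y∣_ : ∀ {ℓ Ψ} → DRel S ℓ Ψ → List (Constraint Ψ) → Rel (Term S (suc Ψ) 0) ℓ
  β ＠y∣ Ξ = β ＠ π ∣ List.map (_[ π ]ᶜ) Ξ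

module Semantics {S : Signature} (O : OpSem S) where
  open OpSem O public

  IsValue : ∀ {ℓ Ψ} → DRel S ℓ Ψ → Set ℓ
  IsValue {Ψ = Ψ} α = ∀ {Ψ'} (ψ : Ψ' ⇒ Ψ) {M M'} → (α ＠ ψ) M M' → Val M × Val M'

  -- The evaluation pattern common to Tm and PTy.
  record Coherent {ℓ Ψ Ψ₁ Ψ₂} (R : Rel (Term S Ψ₂ 0) ℓ) (ψ₁ : Ψ₁ ⇒ Ψ) (ψ₂ : Ψ₂ ⇒ Ψ₁)
                  (M M' : Term S Ψ 0) : Set ℓ where
    field
      {M₁ M₁'}            : Term S Ψ₁ 0
      {M₂ M₁₂ M₂' M₁₂'}   : Term S Ψ₂ 0
      M⇓M₁     : M [ ψ₁ ] ⇓ M₁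
      M₁⇓M₂    : M₁ [ ψ₂ ] ⇓ M₂
      M⇓M₁₂    : M [ ψ₁ ⊙ ψ₂ ] ⇓ M₁₂
      M'⇓M₁'   : M' [ ψ₁ ] ⇓ M₁'
      M₁'⇓M₂'  : M₁' [ ψ₂ ] ⇓ M₂'
      M'⇓M₁₂'  : M' [ ψ₁ ⊙ ψ₂ ] ⇓ M₁₂'
      M₂∼M₂'   : R M₂ M₂'
      M₂∼M₁₂   : R ⟪ M₂ ∷ M₁₂ ∷ [] ⟫
      M₂'∼M₁₂' : R ⟪ M₂' ∷ M₁₂' ∷ [] ⟫

  Tm : ∀ {ℓ Ψ} → DRel S ℓ Ψ → DRel S ℓ Ψ
  Tm α = record { _＠_ = λ {Ψ'} ψ M M' →
    ∀ {Ψ₁ Ψ₂} (ψ₁ : Ψ₁ ⇒ Ψ') (ψ₂ : Ψ₂ ⇒ Ψ₁) → Coherent (α ＠ (ψ ⊙ ψ₁ ⊙ ψ₂)) ψ₁ ψ₂ M M' }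

  ValueCoherent : ∀ {ℓ Ψ} → DRel S ℓ Ψ → Set ℓ
  ValueCoherent {Ψ = Ψ} α = ∀ {Ψ'} (ψ : Ψ' ⇒ Ψ) {V V'} → (α ＠ ψ) V V' → (Tm α ＠ ψ) V V'

  -- The hypotheses on the data of a composition shared by the Kan
  -- condition and by Fhcom.
  record CompositionData {ℓ Ψ Ψ' n} (α : DRel S ℓ Ψ) (ψ : Ψ' ⇒ Ψ) (r : Dim Ψ')
                         (ξs : Vec (Constraint Ψ') n) (M M' : Term S Ψ' 0)
                         (Ns Ns' : Vec (Term S (suc Ψ') 0) n) : Set ℓ where
    field
      valid : Valid ξs
      cap   : (Tm α ＠ ψ) M M'
      tube  : ∀ i j → (Tm α · ψ ＠y∣ (lookup ξs i ∷ lookup ξs j ∷ [])) (lookup Ns i) (lookup Ns' j)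
      adj   : ∀ i → (Tm α ＠ ψ ∣ (lookup ξs i ∷ [])) (lookup Ns i [ ⟨ r /y⟩ ]) M

  record FhcomValues {ℓ Ψ Ψ'} (α : DRel S ℓ Ψ) (ψ : Ψ' ⇒ Ψ) (V V' : Term S Ψ' 0) : Set ℓ where
    field
      {r r'}   : Dim Ψ'
      {n}      : ℕ
      {ξs}     : Vec (Constraint Ψ') n
      {M M'}   : Term S Ψ' 0
      {Ns Ns'} : Vec (Term S (suc Ψ') 0) n
      V≡       : V ≡ fhcom r r' M ξs Ns
      V'≡      : V' ≡ fhcom r r' M' ξs Ns'
      no-ξ     : ∀ i → ¬ (⊨ lookup ξs i)
      r≢r'     : r ≢ r'
      data-ok  : CompositionData α ψ r ξs M M' Ns Ns'

  Fhcom : ∀ {ℓ Ψ} → DRel S ℓ Ψ → DRel S ℓ Ψ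
  Fhcom α = record { _＠_ = FhcomValues α }

  Fhcom-isValue : ∀ {ℓ Ψ} (α : DRel S ℓ Ψ) → IsValue (Fhcom α)
  Fhcom-isValue α ψ record { V≡ = refl ; V'≡ = refl ; no-ξ = no-ξ ; r≢r' = r≢r' } =
    fhcom-Val no-ξ r≢r' , fhcom-Val no-ξ r≢r'

  private
    mapCoherent : ∀ {ℓ Ψ Ψ₁ Ψ₂} {R R' : Rel (Term S Ψ₂ 0) ℓ} {ψ₁ : Ψ₁ ⇒ Ψ} {ψ₂ : Ψ₂ ⇒ Ψ₁} {M M'} →
                  (∀ X X' → R X X' → R' X X') → Coherent R ψ₁ ψ₂ M M' → Coherent R' ψ₁ ψ₂ M M'
    mapCoherent f c = record
      { M⇓M₁ = M⇓M₁ ; M₁⇓M₂ = M₁⇓M₂ ; M⇓M₁₂ = M⇓M₁₂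
      ; M'⇓M₁' = M'⇓M₁' ; M₁'⇓M₂' = M₁'⇓M₂' ; M'⇓M₁₂' = M'⇓M₁₂'
      ; M₂∼M₂' = f _ _ M₂∼M₂'
      ; M₂∼M₁₂ = λ i j → f _ _ (M₂∼M₁₂ i j)
      ; M₂'∼M₁₂' = λ i j → f _ _ (M₂'∼M₁₂' i j) }
      where open Coherent c

    -- An inclusion α_(ψ ψ') ⊆ β_(φ ψ') for all ψ' is inherited by the
    -- data of compositions.
    module _ {ℓ : Level} {Ψ Φ Ψ' : ℕ} {α : DRel S ℓ Ψ} {β : DRel S ℓ Φ} {ψ : Ψ' ⇒ Ψ} {φ : Ψ' ⇒ Φ}
             (f : ∀ {Ψ''} (ψ' : Ψ'' ⇒ Ψ') M M' → (α ＠ (ψ ⊙ ψ')) M M' → (β ＠ (φ ⊙ ψ')) M M') where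

      mapTm : ∀ {M M'} → (Tm α ＠ ψ) M M' → (Tm β ＠ φ) M M'
      mapTm t ψ₁ ψ₂ = mapCoherent
        (λ X X' x → subst (λ χ → (β ＠ χ) X X') (sym (⊙-assoc φ ψ₁ ψ₂))
                      (f (ψ₁ ⊙ ψ₂) X X' (subst (λ χ → (α ＠ χ) X X') (⊙-assoc ψ ψ₁ ψ₂) x)))
        (t ψ₁ ψ₂)

    mapTm⊙ : ∀ {ℓ Ψ Φ Ψ' Ψ''} {α : DRel S ℓ Ψ} {β : DRel S ℓ Φ} {ψ : Ψ' ⇒ Ψ} {φ : Ψ' ⇒ Φ}
             (f : ∀ {Ψ''} (ψ' : Ψ'' ⇒ Ψ') M M' → (α ＠ (ψ ⊙ ψ')) M M' → (β ＠ (φ ⊙ ψ')) M M')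
             (χ : Ψ'' ⇒ Ψ') {M M'} → (Tm α ＠ (ψ ⊙ χ)) M M' → (Tm β ＠ (φ ⊙ χ)) M M'
    mapTm⊙ {α = α} {β} {ψ} {φ} f χ = mapTm {α = α} {β = β}
      λ ψ' X X' x → subst (λ ω → (β ＠ ω) X X') (sym (⊙-assoc φ χ ψ'))
                      (f (χ ⊙ ψ') X X' (subst (λ ω → (α ＠ ω) X X') (⊙-assoc ψ χ ψ') x))

    mapFhcom : ∀ {ℓ Ψ Φ Ψ'} (α : DRel S ℓ Ψ) (β : DRel S ℓ Φ) (ψ : Ψ' ⇒ Ψ) (φ : Ψ' ⇒ Φ)
               (f : ∀ {Ψ''} (ψ' : Ψ'' ⇒ Ψ') M M' → (α ＠ (ψ ⊙ ψ')) M M' → (β ＠ (φ ⊙ ψ')) M M') →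
               ∀ {M M'} → (Fhcom α ＠ ψ) M M' → (Fhcom β ＠ φ) M M'
    mapFhcom α β ψ φ f v = record
      { V≡ = V≡ ; V'≡ = V'≡ ; no-ξ = no-ξ ; r≢r' = r≢r'
      ; data-ok = record
        { valid = valid
        ; cap   = mapTm {α = α} {β = β} f cap
        ; tube  = λ i j ψ' s → mapTm⊙ {α = α} {β = β} f (π ⊙ ψ') (tube i j ψ' s)
        ; adj   = λ i ψ' s → mapTm⊙ {α = α} {β = β} f ψ' (adj i ψ' s) } }
      where open FhcomValues v
            open CompositionData data-ok

  Fhcom-cong : ∀ {ℓ Ψ} {α β : DRel S ℓ Ψ} → α ≋ β → Fhcom α ≋ Fhcom β
  Fhcom-cong {α = α} {β} e ψ M M' = mk⇔
    (mapFhcom α β ψ ψ λ ψ' X X' → Equivalence.to   (e (ψ ⊙ ψ') X X'))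
    (mapFhcom β α ψ ψ λ ψ' X X' → Equivalence.from (e (ψ ⊙ ψ') X X'))

  Fhcom-· : ∀ {ℓ Ψ Ψ'} (α : DRel S ℓ Ψ) (ψ : Ψ' ⇒ Ψ) → Fhcom α · ψ ≋ Fhcom (α · ψ)
  Fhcom-· α ψ ψ' M M' = mk⇔
    (mapFhcom α (α · ψ) (ψ ⊙ ψ') ψ' λ ψ'' X X' → subst (λ ω → (α ＠ ω) X X') (⊙-assoc ψ ψ' ψ''))
    (mapFhcom (α · ψ) α ψ' (ψ ⊙ ψ') λ ψ'' X X' → subst (λ ω → (α ＠ ω) X X') (sym (⊙-assoc ψ ψ' ψ'')))

  record Candidate (ℓ ℓ' : Level) : Set (lsuc (ℓ ⊔ ℓ')) where
    field
      τ     : (Ψ : ℕ) (A A' : Term S Ψ 0) (φ : Rel (Term S Ψ 0) ℓ) → Set ℓ'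
      τ-val : ∀ {Ψ A A' φ} → τ Ψ A A' φ → Val A × Val A'
      φ-val : ∀ {Ψ A A' φ} → τ Ψ A A' φ → ∀ {V V'} → φ V V' → Val V × Val V'
      -- Relations are sets of pairs, so τ cannot distinguish extensionally
      -- equal ones.
      τ-ext : ∀ {Ψ A A' φ φ'} → (∀ V V' → φ V V' ⇔ φ' V V') → τ Ψ A A' φ → τ Ψ A A' φ'

    PTy : ∀ {Ψ} → Term S Ψ 0 → Term S Ψ 0 → DRel S ℓ Ψ → Set ℓ'
    PTy {Ψ} A A' α = ∀ {Ψ₁ Ψ₂} (ψ₁ : Ψ₁ ⇒ Ψ) (ψ₂ : Ψ₂ ⇒ Ψ₁) →
      Coherent (λ B B' → τ Ψ₂ B B' (α ＠ (ψ₁ ⊙ ψ₂))) ψ₁ ψ₂ A A'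

  record CubicalTypeSystem (ℓ ℓ' : Level) : Set (lsuc (ℓ ⊔ ℓ')) where
    field candidate : Candidate ℓ ℓ'
    open Candidate candidate public
    field
      φ-unique : ∀ {Ψ A A' φ φ'} → τ Ψ A A' φ → τ Ψ A A' φ' → ∀ V V' → φ V V' ⇔ φ' V V'
      φ-PER    : ∀ {Ψ A A' φ} → τ Ψ A A' φ → IsPartialEquivalence φ
      τ-PER    : ∀ {Ψ φ} → IsPartialEquivalence (λ A A' → τ Ψ A A' φ)
      τ⇒PTy    : ∀ {Ψ A A' φ} → τ Ψ A A' φ → Σ[ α ∈ DRel S ℓ Ψ ] IsValue α × PTy A A' α

  module TypeTheory {ℓ ℓ' : Level} (T : CubicalTypeSystem ℓ ℓ') where
    open CubicalTypeSystem T

    -- A ≐ A' type_pre [Ψ]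
    record PreType {Ψ} (A A' : Term S Ψ 0) : Set (lsuc ℓ ⊔ ℓ') where
      field
        ⟦_⟧ty         : DRel S ℓ Ψ
        isValue       : IsValue ⟦_⟧ty
        pty           : PTy A A' ⟦_⟧ty
        valueCoherent : ValueCoherent ⟦_⟧ty
    open PreType public using (⟦_⟧ty)

    -- M ≐ M' ∈ A [Ψ], including the presupposition that A is a pretype.
    infix 4 _≐_∈ty_
    _≐_∈ty_ : ∀ {Ψ} → Term S Ψ 0 → Term S Ψ 0 → Term S Ψ 0 → Set (lsuc ℓ ⊔ ℓ')
    M ≐ M' ∈ty A = Σ[ A-pre ∈ PreType A A ] (Tm ⟦ A-pre ⟧ty ＠ idᵈ) M M'

    -- A ≐ A' type_Kan [Ψ]
    record KanType {Ψ} (A A' : Term S Ψ 0) : Set (lsuc ℓ ⊔ ℓ') where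
      field pre : PreType A A'
      α : DRel S ℓ Ψ
      α = ⟦ pre ⟧ty
      field
        hcom-kan : ∀ {Ψ' n} (ψ : Ψ' ⇒ Ψ) (r r' : Dim Ψ') (ξs : Vec (Constraint Ψ') n) {M M' Ns Ns'} →
          CompositionData α ψ r ξs M M' Ns Ns' →
          let H  = λ s → hcom (A  [ ψ ]) r s M  ξs Ns
              H' = λ s → hcom (A' [ ψ ]) r s M' ξs Ns'
          in (Tm α ＠ ψ) (H r') (H' r')
           × (Tm α ＠ ψ) (H r) M
           × (∀ i → (Tm α ＠ ψ ∣ (lookup ξs i ∷ [])) (H r') (lookup Ns i [ ⟨ r' /y⟩ ]))
        coe-kan : ∀ {Ψ'} (ψ : suc Ψ' ⇒ Ψ) (r r' : Dim Ψ') {M M'} →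
          (Tm α ＠ (ψ ⊙ ⟨ r /y⟩)) M M' →
          (Tm α ＠ (ψ ⊙ ⟨ r' /y⟩)) (coe (A [ ψ ]) r r' M) (coe (A' [ ψ ]) r r' M')
          × (Tm α ＠ (ψ ⊙ ⟨ r /y⟩)) (coe (A [ ψ ]) r r M) M

    -- Telescopes of n types over Ψ; the last entry is term variable 0.
    infixl 5 _▷_
    data Tele (Ψ : ℕ) : ℕ → Set where
      ε   : Tele Ψ 0
      _▷_ : ∀ {n} → Tele Ψ n → Term S Ψ n → Tele Ψ (suc n)

    infixl 9 _[_]ᵗ
    _[_]ᵗ : ∀ {Ψ Ψ' n} → Tele Ψ n → Ψ' ⇒ Ψ → Tele Ψ' n
    ε       [ ψ ]ᵗ = ε
    (Δ ▷ A) [ ψ ]ᵗ = Δ [ ψ ]ᵗ ▷ A [ ψ ]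

    infix 4 _≐_∈_ _∈ᵗ_
    _≐_∈_ : ∀ {Ψ n} → Vec (Term S Ψ 0) n → Vec (Term S Ψ 0) n → Tele Ψ n → Set (lsuc ℓ ⊔ ℓ')
    []      ≐ []        ∈ ε       = ⊤
    (M ∷ I) ≐ (M' ∷ I') ∈ (Δ ▷ A) = (I ≐ I' ∈ Δ) × (M ≐ M' ∈ty A ⟦ I ⟧)

    _∈ᵗ_ : ∀ {Ψ n} → Vec (Term S Ψ 0) n → Tele Ψ n → Set (lsuc ℓ ⊔ ℓ')
    I ∈ᵗ Δ = I ≐ I ∈ Δ

    -- Δ ≫ A ≐ A' type_Kan [Ψ]
    OpenKanType : ∀ {Ψ n} → Tele Ψ n → Term S Ψ n → Term S Ψ n → Set (lsuc ℓ ⊔ ℓ')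
    OpenKanType {Ψ} Δ A A' = ∀ {Ψ'} (ψ : Ψ' ⇒ Ψ) {I I'} → I ≐ I' ∈ Δ [ ψ ]ᵗ →
      KanType (A [ ψ ] ⟦ I ⟧) (A' [ ψ ] ⟦ I' ⟧)

    infix 4 _≐_ctxKan _ctxKan
    _≐_ctxKan : ∀ {Ψ n} → Tele Ψ n → Tele Ψ n → Set (lsuc ℓ ⊔ ℓ')
    ε       ≐ ε         ctxKan = ⊤
    (Δ ▷ A) ≐ (Δ' ▷ A') ctxKan = (Δ ≐ Δ' ctxKan) × OpenKanType Δ A A'

    _ctxKan : ∀ {Ψ n} → Tele Ψ n → Set (lsuc ℓ ⊔ ℓ')
    Δ ctxKan = Δ ≐ Δ ctxKan

    -- In stable, Iψ' ∈ Δ(ψψ') follows from I ∈ Δψ, since equality of lists is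
    -- closed under dimension substitution; by resp, components do not
    -- depend on the membership proof.
    record IndexedRel (κ : Level) {Ψ n} (Δ : Tele Ψ n) : Set (lsuc κ ⊔ lsuc ℓ ⊔ ℓ') where
      field
        at     : ∀ {Ψ'} (ψ : Ψ' ⇒ Ψ) (I : Vec (Term S Ψ' 0) n) → I ∈ᵗ Δ [ ψ ]ᵗ → DRel S κ Ψ'
        stable : ∀ {Ψ' Ψ''} (ψ : Ψ' ⇒ Ψ) I (I∈ : I ∈ᵗ Δ [ ψ ]ᵗ) (ψ' : Ψ'' ⇒ Ψ')
                 (Iψ'∈ : dsubs I ψ' ∈ᵗ Δ [ ψ ⊙ ψ' ]ᵗ) → at ψ I I∈ · ψ' ≋ at (ψ ⊙ ψ') (dsubs I ψ') Iψ'∈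
        resp   : ∀ {Ψ'} (ψ : Ψ' ⇒ Ψ) {I I'} (I∈ : I ∈ᵗ Δ [ ψ ]ᵗ) (I'∈ : I' ∈ᵗ Δ [ ψ ]ᵗ) →
                 I ≐ I' ∈ Δ [ ψ ]ᵗ → at ψ I I∈ ≋ at ψ I' I'∈
    open IndexedRel public

    module _ {κ : Level} {Ψ n : ℕ} {Δ : Tele Ψ n} where

      IsValueᴵ : IndexedRel κ Δ → Set (κ ⊔ lsuc ℓ ⊔ ℓ')
      IsValueᴵ α = ∀ {Ψ'} (ψ : Ψ' ⇒ Ψ) I (I∈ : I ∈ᵗ Δ [ ψ ]ᵗ) → IsValue (at α ψ I I∈)

      IsPERᴵ : IndexedRel κ Δ → Set (κ ⊔ lsuc ℓ ⊔ ℓ')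
      IsPERᴵ α = ∀ {Ψ'} (ψ : Ψ' ⇒ Ψ) I (I∈ : I ∈ᵗ Δ [ ψ ]ᵗ) → IsPER (at α ψ I I∈)

      infixr 6 _∪ᴵ_
      _∪ᴵ_ : IndexedRel κ Δ → IndexedRel κ Δ → IndexedRel κ Δ
      α ∪ᴵ β = record
        { at     = λ ψ I I∈ → at α ψ I I∈ ∪ at β ψ I I∈
        ; stable = λ ψ I I∈ ψ' Iψ'∈ ψ'' M M' →
            stable α ψ I I∈ ψ' Iψ'∈ ψ'' M M' Sum.⊎-⇔ stable β ψ I I∈ ψ' Iψ'∈ ψ'' M M'
        ; resp   = λ ψ I∈ I'∈ e ψ' M M' →
            resp α ψ I∈ I'∈ e ψ' M M' Sum.⊎-⇔ resp β ψ I∈ I'∈ e ψ' M M' }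

      -- By stability of α, the component of Fhcom (α_ψ[I]) at ψ' is the
      -- identity component of Fhcom (α_(ψ ψ')[I ψ']), so Fhcomᴵ α is the
      -- indexed relation determined by those identity components.
      Fhcomᴵ : IndexedRel κ Δ → IndexedRel κ Δ
      Fhcomᴵ α = record
        { at     = λ ψ I I∈ → Fhcom (at α ψ I I∈)
        ; stable = λ ψ I I∈ ψ' Iψ'∈ ψ'' M M' → ⇔-trans
            (Fhcom-· (at α ψ I I∈) ψ' ψ'' M M')
            (Fhcom-cong {α = at α ψ I I∈ · ψ'} (stable α ψ I I∈ ψ' Iψ'∈) ψ'' M M')
        ; resp   = λ ψ {I} I∈ I'∈ e → Fhcom-cong {α = at α ψ I I∈} (resp α ψ I∈ I'∈ e) }

      Fhcomᴵ-isValue : (α : IndexedRel κ Δ) → IsValueᴵ (Fhcomᴵ α)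
      Fhcomᴵ-isValue α ψ I I∈ = Fhcom-isValue (at α ψ I I∈)

{-# OPTIONS --safe #-}
-- Under any substitution, fhcom r r' M ξs Ns either steps to the tube N_j⟨r'/y⟩
-- of the least true ξ_j, or steps to M, or is a value.  All true tubes agree
-- with one another, and with M when r = r', so closure of Tm under head
-- expansion gives (a) and (b).  For (c), after the first substitution the two
-- compositions either step, and are then related in Tm α by (a) or (b), or are
-- values and hence do not change before the second substitution.
module Submission where

open import Defs
open import Level using (Level)
open import Data.Nat.Base using (ℕ; suc; zero; _+_; s<s)
open import Data.Fin.Base using (Fin; zero; suc; _<_)
import Data.Fin.Properties as Fin
open import Data.List.Base using ([]; _∷_)
open import Data.List.Relation.Unary.All using (All; []; _∷_)
open import Data.Product.Base using (_×_; _,_; ∃-syntax; proj₁; proj₂)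
open import Data.Sum.Base using (_⊎_; inj₁; inj₂)
open import Data.Vec.Base as Vec using (Vec; []; _∷_; lookup)
open import Data.Vec.Membership.Propositional.Properties using (∈-map⁺)
open import Data.Vec.Properties
  using (lookup-map; lookup∘tabulate; map-cong; map-id; map-∘; tabulate-∘; tabulate∘lookup)
import Data.Vec.Relation.Unary.Any as Any
import Data.Vec.Relation.Unary.Any.Properties as Any
open import Relation.Binary.Construct.Closure.ReflexiveTransitive using (Star; ε; _◅_; _◅◅_)
open import Relation.Binary.Core using (Rel)
open import Relation.Binary.Definitions using (DecidableEquality)
open import Relation.Binary.PropositionalEquality
  using (_≡_; _≢_; refl; sym; trans; cong; cong₂; subst; module ≡-Reasoning)
open import Relation.Binary.Structures using (IsPartialEquivalence)
open import Relation.Nullary using (¬_; yes; no; contradiction)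
open import Relation.Nullary.Decidable using (map′)

-- Decidability of constraints

_≟ᵈ_ : ∀ {Ψ} → DecidableEquality (Dim Ψ)
𝟎     ≟ᵈ 𝟎     = yes refl
𝟎     ≟ᵈ 𝟏     = no λ ()
𝟎     ≟ᵈ var _ = no λ ()
𝟏     ≟ᵈ 𝟎     = no λ ()
𝟏     ≟ᵈ 𝟏     = yes refl
𝟏     ≟ᵈ var _ = no λ ()
var _ ≟ᵈ 𝟎     = no λ ()
var _ ≟ᵈ 𝟏     = no λ ()
var x ≟ᵈ var y = map′ (cong var) (λ { refl → refl }) (x Fin.≟ y)

-- The two alternatives are shaped as premises of the operational rules: the first feeds
-- `fhcom-tube`, the second feeds `fhcom-cap` and `fhcom-Val`.
leastTrue : ∀ {Ψ n} (ξs : Vec (Constraint Ψ) n) →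
            (∃[ i ] ⊨ lookup ξs i × (∀ j → j < i → ¬ (⊨ lookup ξs j)))
            ⊎ (∀ i → ¬ (⊨ lookup ξs i))
leastTrue []                = inj₂ λ ()
leastTrue ((r ＝ r') ∷ ξs) with r ≟ᵈ r' | leastTrue ξs
... | yes r≡r' | _                      = inj₁ (zero , r≡r' , λ _ ())
... | no  r≢r' | inj₁ (i , ξᵢ , least)  =
  inj₁ (suc i , ξᵢ , λ { zero _ → r≢r' ; (suc j) (s<s j<i) → least j j<i })
... | no  r≢r' | inj₂ none              = inj₂ λ { zero → r≢r' ; (suc i) → none i }

-- Functoriality of dimension substitution

[idᵈ]ᵈ : ∀ {Ψ} (r : Dim Ψ) → r [ idᵈ ]ᵈ ≡ r
[idᵈ]ᵈ 𝟎       = refl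
[idᵈ]ᵈ 𝟏       = refl
[idᵈ]ᵈ (var x) = lookup∘tabulate var x

⊙-identityʳ : ∀ {Ψ Ψ'} (ψ : Ψ' ⇒ Ψ) → ψ ⊙ idᵈ ≡ ψ
⊙-identityʳ ψ = trans (map-cong [idᵈ]ᵈ ψ) (map-id ψ)

⊙-identityˡ : ∀ {Ψ Ψ'} (ψ : Ψ' ⇒ Ψ) → idᵈ ⊙ ψ ≡ ψ
⊙-identityˡ ψ = trans (sym (tabulate-∘ (_[ ψ ]ᵈ) var)) (tabulate∘lookup ψ)

π-⊙-∷ : ∀ {Ψ Ψ'} (r : Dim Ψ') (ψ : Ψ' ⇒ Ψ) → π ⊙ (r ∷ ψ) ≡ ψ
π-⊙-∷ r ψ = trans (sym (tabulate-∘ (_[ r ∷ ψ ]ᵈ) (λ x → var (Fin.suc x)))) (tabulate∘lookup ψ)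

⊙-π-∷ : ∀ {Ψ Ψ' Ψ''} (ψ : Ψ' ⇒ Ψ) (r : Dim Ψ'') (ψ' : Ψ'' ⇒ Ψ') → ψ ⊙ π ⊙ (r ∷ ψ') ≡ ψ ⊙ ψ'
⊙-π-∷ ψ r ψ' = trans (⊙-assoc ψ π (r ∷ ψ')) (cong (ψ ⊙_) (π-⊙-∷ r ψ'))

liftᵈ-idᵈ : ∀ {Ψ} k → liftᵈ k (idᵈ {Ψ}) ≡ idᵈ
liftᵈ-idᵈ zero    = refl
liftᵈ-idᵈ (suc k) = cong (var zero ∷_) (trans (cong (_⊙ π) (liftᵈ-idᵈ k)) (⊙-identityˡ π))

liftᵈ-⊙ : ∀ {Ψ Ψ' Ψ''} k (ψ : Ψ' ⇒ Ψ) (ψ' : Ψ'' ⇒ Ψ') → liftᵈ k (ψ ⊙ ψ') ≡ liftᵈ k ψ ⊙ liftᵈ k ψ'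
liftᵈ-⊙ zero    ψ ψ' = refl
liftᵈ-⊙ (suc k) ψ ψ' = cong (var zero ∷_) (begin
  liftᵈ k (ψ ⊙ ψ') ⊙ π                               ≡⟨ cong (_⊙ π) (liftᵈ-⊙ k ψ ψ') ⟩
  liftᵈ k ψ ⊙ liftᵈ k ψ' ⊙ π                         ≡⟨ ⊙-assoc (liftᵈ k ψ) (liftᵈ k ψ') π ⟩
  liftᵈ k ψ ⊙ (liftᵈ k ψ' ⊙ π)                       ≡⟨ ⊙-π-∷ (liftᵈ k ψ) (var zero) (liftᵈ k ψ' ⊙ π) ⟨
  liftᵈ k ψ ⊙ π ⊙ (var zero ∷ (liftᵈ k ψ' ⊙ π))      ∎)
  where open ≡-Reasoning

-- Tubes are related over `π`; this identifies a tube of a substituted composition with an instance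
-- of the original tube.
π-⊙-liftᵈ : ∀ {Ψ Ψ' Ψ''} (ψ : Ψ' ⇒ Ψ) (ψ' : Ψ'' ⇒ suc Ψ') → π ⊙ (liftᵈ 1 ψ ⊙ ψ') ≡ ψ ⊙ (π ⊙ ψ')
π-⊙-liftᵈ ψ ψ' = trans (π-⊙-∷ _ (ψ ⊙ π ⊙ ψ')) (⊙-assoc ψ π ψ')

liftᵈ-⊙-⟨/y⟩ : ∀ {Ψ Ψ'} (r : Dim Ψ) (ψ : Ψ' ⇒ Ψ) → liftᵈ 1 ψ ⊙ ⟨ r [ ψ ]ᵈ /y⟩ ≡ ⟨ r /y⟩ ⊙ ψ
liftᵈ-⊙-⟨/y⟩ r ψ = cong (r [ ψ ]ᵈ ∷_) (begin
  ψ ⊙ π ⊙ ⟨ r [ ψ ]ᵈ /y⟩  ≡⟨ ⊙-π-∷ ψ (r [ ψ ]ᵈ) idᵈ ⟩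
  ψ ⊙ idᵈ                 ≡⟨ ⊙-identityʳ ψ ⟩
  ψ                       ≡⟨ ⊙-identityˡ ψ ⟨
  idᵈ ⊙ ψ                 ∎)
  where open ≡-Reasoning

-- Constraints and validity under substitution

[]ᶜ-⊙ : ∀ {Ψ Ψ' Ψ''} (ξ : Constraint Ψ) (ψ : Ψ' ⇒ Ψ) (ψ' : Ψ'' ⇒ Ψ') →
        ξ [ ψ ⊙ ψ' ]ᶜ ≡ ξ [ ψ ]ᶜ [ ψ' ]ᶜ
[]ᶜ-⊙ (r ＝ r') ψ ψ' = cong₂ _＝_ ([]ᵈ-⊙ r ψ ψ') ([]ᵈ-⊙ r' ψ ψ')

[idᵈ]ᶜ : ∀ {Ψ} (ξ : Constraint Ψ) → ξ [ idᵈ ]ᶜ ≡ ξ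
[idᵈ]ᶜ (r ＝ r') = cong₂ _＝_ ([idᵈ]ᵈ r) ([idᵈ]ᵈ r')

⊨-[]ᶜ : ∀ {Ψ Ψ'} (ξ : Constraint Ψ) (ψ : Ψ' ⇒ Ψ) → ⊨ ξ → ⊨ ξ [ ψ ]ᶜ
⊨-[]ᶜ (r ＝ r') ψ = cong (_[ ψ ]ᵈ)

⊨-lookup-map⁺ : ∀ {Ψ Ψ' n} (ξs : Vec (Constraint Ψ) n) (ψ : Ψ' ⇒ Ψ) i →
                ⊨ lookup ξs i [ ψ ]ᶜ → ⊨ lookup (Vec.map (_[ ψ ]ᶜ) ξs) i
⊨-lookup-map⁺ ξs ψ i = subst ⊨_ (sym (lookup-map i (_[ ψ ]ᶜ) ξs))

⊨-lookup-map⁻ : ∀ {Ψ Ψ' n} (ξs : Vec (Constraint Ψ) n) (ψ : Ψ' ⇒ Ψ) i →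
                ⊨ lookup (Vec.map (_[ ψ ]ᶜ) ξs) i → ⊨ lookup ξs i [ ψ ]ᶜ
⊨-lookup-map⁻ ξs ψ i = subst ⊨_ (lookup-map i (_[ ψ ]ᶜ) ξs)

Valid-[]ᶜ : ∀ {Ψ Ψ' n} {ξs : Vec (Constraint Ψ) n} (ψ : Ψ' ⇒ Ψ) → Valid ξs → Valid (Vec.map (_[ ψ ]ᶜ) ξs)
Valid-[]ᶜ ψ (inj₁ some)            = inj₁ (Any.map⁺ (Any.map (λ {ξ} → ⊨-[]ᶜ ξ ψ) some))
Valid-[]ᶜ ψ (inj₂ (r , r=0 , r=1)) = inj₂ (r [ ψ ]ᵈ , ∈-map⁺ (_[ ψ ]ᶜ) r=0 , ∈-map⁺ (_[ ψ ]ᶜ) r=1)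

-- Functoriality on terms

module _ {S : Signature} where

  lookup-dsubs : ∀ {Ψ Ψ' Γ n} (Ns : Vec (Term S Ψ Γ) n) (ψ : Ψ' ⇒ Ψ) i →
                 lookup (dsubs Ns ψ) i ≡ lookup Ns i [ ψ ]
  lookup-dsubs (N ∷ Ns) ψ zero    = refl
  lookup-dsubs (N ∷ Ns) ψ (suc i) = lookup-dsubs Ns ψ i

  private
    hcom-cong : ∀ {Ψ Γ n} {A B : Term S Ψ Γ} {r r' s s' M L} {ξs ζs : Vec (Constraint Ψ) n} {Ns Ks} →
                A ≡ B → r ≡ s → r' ≡ s' → M ≡ L → ξs ≡ ζs → Ns ≡ Ks →
                hcom A r r' M ξs Ns ≡ hcom B s s' L ζs Ks
    hcom-cong refl refl refl refl refl refl = refl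

    coe-cong : ∀ {Ψ Γ} {A B : Term S (suc Ψ) Γ} {r r' s s' M L} →
               A ≡ B → r ≡ s → r' ≡ s' → M ≡ L → Term.coe A r r' M ≡ coe B s s' L
    coe-cong refl refl refl refl = refl

    fhcom-cong : ∀ {Ψ Γ n} {r r' s s'} {M L : Term S Ψ Γ} {ξs ζs : Vec (Constraint Ψ) n} {Ns Ks} →
                 r ≡ s → r' ≡ s' → M ≡ L → ξs ≡ ζs → Ns ≡ Ks →
                 fhcom r r' M ξs Ns ≡ fhcom s s' L ζs Ks
    fhcom-cong refl refl refl refl refl = refl

    map-[]ᶜ-⊙ : ∀ {Ψ Ψ' Ψ'' n} (ξs : Vec (Constraint Ψ) n) (ψ : Ψ' ⇒ Ψ) (ψ' : Ψ'' ⇒ Ψ') →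
                Vec.map (_[ ψ ⊙ ψ' ]ᶜ) ξs ≡ Vec.map (_[ ψ' ]ᶜ) (Vec.map (_[ ψ ]ᶜ) ξs)
    map-[]ᶜ-⊙ ξs ψ ψ' = trans (map-cong (λ ξ → []ᶜ-⊙ ξ ψ ψ') ξs) (map-∘ _ _ ξs)

  mutual
    []-⊙ : ∀ {Ψ Ψ' Ψ'' Γ} (M : Term S Ψ Γ) (ψ : Ψ' ⇒ Ψ) (ψ' : Ψ'' ⇒ Ψ') →
           M [ ψ ⊙ ψ' ] ≡ M [ ψ ] [ ψ' ]
    []-⊙ (var a)               ψ ψ' = refl
    []-⊙ (op o rs as)          ψ ψ' = cong₂ (op o) (sym (⊙-assoc rs ψ ψ')) (dsubArgs-⊙ as ψ ψ')
    []-⊙ (hcom A r r' M ξs Ns) ψ ψ' =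
      hcom-cong ([]-⊙ A ψ ψ') ([]ᵈ-⊙ r ψ ψ') ([]ᵈ-⊙ r' ψ ψ') ([]-⊙ M ψ ψ') (map-[]ᶜ-⊙ ξs ψ ψ')
        (trans (cong (dsubs Ns) (liftᵈ-⊙ 1 ψ ψ')) (dsubs-⊙ Ns (liftᵈ 1 ψ) (liftᵈ 1 ψ')))
    []-⊙ (coe A r r' M)        ψ ψ' =
      coe-cong (trans (cong (A [_]) (liftᵈ-⊙ 1 ψ ψ')) ([]-⊙ A (liftᵈ 1 ψ) (liftᵈ 1 ψ')))
        ([]ᵈ-⊙ r ψ ψ') ([]ᵈ-⊙ r' ψ ψ') ([]-⊙ M ψ ψ')
    []-⊙ (fhcom r r' M ξs Ns)  ψ ψ' =
      fhcom-cong ([]ᵈ-⊙ r ψ ψ') ([]ᵈ-⊙ r' ψ ψ') ([]-⊙ M ψ ψ') (map-[]ᶜ-⊙ ξs ψ ψ')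
        (trans (cong (dsubs Ns) (liftᵈ-⊙ 1 ψ ψ')) (dsubs-⊙ Ns (liftᵈ 1 ψ) (liftᵈ 1 ψ')))

    dsubArgs-⊙ : ∀ {Ψ Ψ' Ψ'' Γ as} (Ms : All (λ (k , m) → Term S (k + Ψ) (m + Γ)) as)
                 (ψ : Ψ' ⇒ Ψ) (ψ' : Ψ'' ⇒ Ψ') →
                 dsubArgs Ms (ψ ⊙ ψ') ≡ dsubArgs (dsubArgs Ms ψ) ψ'
    dsubArgs-⊙ []                     ψ ψ' = refl
    dsubArgs-⊙ (_∷_ {x = k , m} M Ms) ψ ψ' = cong₂ _∷_
      (trans (cong (M [_]) (liftᵈ-⊙ k ψ ψ')) ([]-⊙ M (liftᵈ k ψ) (liftᵈ k ψ')))
      (dsubArgs-⊙ Ms ψ ψ')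

    dsubs-⊙ : ∀ {Ψ Ψ' Ψ'' Γ n} (Ms : Vec (Term S Ψ Γ) n) (ψ : Ψ' ⇒ Ψ) (ψ' : Ψ'' ⇒ Ψ') →
              dsubs Ms (ψ ⊙ ψ') ≡ dsubs (dsubs Ms ψ) ψ'
    dsubs-⊙ []       ψ ψ' = refl
    dsubs-⊙ (M ∷ Ms) ψ ψ' = cong₂ _∷_ ([]-⊙ M ψ ψ') (dsubs-⊙ Ms ψ ψ')

  mutual
    [idᵈ] : ∀ {Ψ Γ} (M : Term S Ψ Γ) → M [ idᵈ ] ≡ M
    [idᵈ] (var a)               = refl
    [idᵈ] (op o rs as)          = cong₂ (op o) (⊙-identityʳ rs) (dsubArgs-idᵈ as)
    [idᵈ] (hcom A r r' M ξs Ns) =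
      hcom-cong ([idᵈ] A) ([idᵈ]ᵈ r) ([idᵈ]ᵈ r') ([idᵈ] M) (trans (map-cong [idᵈ]ᶜ ξs) (map-id ξs))
        (trans (cong (dsubs Ns) (liftᵈ-idᵈ 1)) (dsubs-idᵈ Ns))
    [idᵈ] (coe A r r' M)        =
      coe-cong (trans (cong (A [_]) (liftᵈ-idᵈ 1)) ([idᵈ] A)) ([idᵈ]ᵈ r) ([idᵈ]ᵈ r') ([idᵈ] M)
    [idᵈ] (fhcom r r' M ξs Ns)  =
      fhcom-cong ([idᵈ]ᵈ r) ([idᵈ]ᵈ r') ([idᵈ] M) (trans (map-cong [idᵈ]ᶜ ξs) (map-id ξs))
        (trans (cong (dsubs Ns) (liftᵈ-idᵈ 1)) (dsubs-idᵈ Ns))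

    dsubArgs-idᵈ : ∀ {Ψ Γ as} (Ms : All (λ (k , m) → Term S (k + Ψ) (m + Γ)) as) →
                   dsubArgs Ms idᵈ ≡ Ms
    dsubArgs-idᵈ []                     = refl
    dsubArgs-idᵈ (_∷_ {x = k , m} M Ms) =
      cong₂ _∷_ (trans (cong (M [_]) (liftᵈ-idᵈ k)) ([idᵈ] M)) (dsubArgs-idᵈ Ms)

    dsubs-idᵈ : ∀ {Ψ Γ n} (Ms : Vec (Term S Ψ Γ) n) → dsubs Ms idᵈ ≡ Ms
    dsubs-idᵈ []       = refl
    dsubs-idᵈ (M ∷ Ms) = cong₂ _∷_ ([idᵈ] M) (dsubs-idᵈ Ms)

  [⟨/y⟩]-[] : ∀ {Ψ Ψ' Γ} (N : Term S (suc Ψ) Γ) (r : Dim Ψ) (ψ : Ψ' ⇒ Ψ) →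
              N [ liftᵈ 1 ψ ] [ ⟨ r [ ψ ]ᵈ /y⟩ ] ≡ N [ ⟨ r /y⟩ ] [ ψ ]
  [⟨/y⟩]-[] N r ψ = trans (sym ([]-⊙ N _ _)) (trans (cong (N [_]) (liftᵈ-⊙-⟨/y⟩ r ψ)) ([]-⊙ N _ _))

  -- The left side is what `fhcom-tube` yields from a substituted composition; the right side is the
  -- form in which the relations between tubes are given.
  lookup-dsubs-⟨/y⟩ : ∀ {Ψ Ψ' Γ n} (Ns : Vec (Term S (suc Ψ) Γ) n) (r : Dim Ψ) (ψ : Ψ' ⇒ Ψ) i →
                      lookup (dsubs Ns (liftᵈ 1 ψ)) i [ ⟨ r [ ψ ]ᵈ /y⟩ ] ≡ lookup Ns i [ ⟨ r /y⟩ ] [ ψ ]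
  lookup-dsubs-⟨/y⟩ Ns r ψ i =
    trans (cong (_[ ⟨ r [ ψ ]ᵈ /y⟩ ]) (lookup-dsubs Ns (liftᵈ 1 ψ) i)) ([⟨/y⟩]-[] (lookup Ns i) r ψ)

⟪⟫-pair : ∀ {a ℓ} {X : Set a} {R : Rel X ℓ} → IsPartialEquivalence R →
          ∀ {x y} → R x y → R ⟪ x ∷ y ∷ [] ⟫
⟪⟫-pair per Rxy = λ
  { zero       zero       → P.trans Rxy (P.sym Rxy)
  ; zero       (suc zero) → Rxy
  ; (suc zero) zero       → P.sym Rxy
  ; (suc zero) (suc zero) → P.trans (P.sym Rxy) Rxy }
  where module P = IsPartialEquivalence per

-- Serves the case where `M₂` and `M₁₂` are the same term, so that all four instances are one
-- self-relation.
⟪⟫-diagonal : ∀ {a ℓ} {X : Set a} (R : Rel X ℓ) {x} → R x x → R ⟪ x ∷ x ∷ [] ⟫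
⟪⟫-diagonal R Rxx = λ
  { zero       zero       → Rxx
  ; zero       (suc zero) → Rxx
  ; (suc zero) zero       → Rxx
  ; (suc zero) (suc zero) → Rxx }

-- Evaluation and coherence

module _ {S : Signature} (O : OpSem S) where
  open Semantics O

  ⇓-unique : ∀ {Ψ} {M V W : Term S Ψ 0} → M ⇓ V → M ⇓ W → V ≡ W
  ⇓-unique (ss , vV) (ts , vW) = unique ss ts vV vW
    where
    unique : ∀ {M V W} → Star _↦_ M V → Star _↦_ M W → Val V → Val W → V ≡ W
    unique ε        ε        vV vW = refl
    unique ε        (t ◅ _)  vV vW = contradiction t (Val-↦ vV)
    unique (s ◅ _)  ε        vV vW = contradiction s (Val-↦ vW)
    unique (s ◅ ss) (t ◅ ts) vV vW with refl ← ↦-deterministic s t = unique ss ts vV vW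

  ↦*-⇓ : ∀ {Ψ} {M N V : Term S Ψ 0} → Star _↦_ M N → N ⇓ V → M ⇓ V
  ↦*-⇓ ss (ts , vV) = ss ◅◅ ts , vV

  Val-⇓ : ∀ {Ψ} {V : Term S Ψ 0} → Val V → V ⇓ V
  Val-⇓ vV = ε , vV

  -- Coherence sees a term only through its instances at `ψ₁` and `ψ₁ ⊙ ψ₂`, and by functoriality
  -- the former determines the latter. Hence a substitution can be moved between the term and `ψ₁`.
  Coherent-map : ∀ {ℓ Ψ Φ Ψ₁ Ψ₂} {R R' : Rel (Term S Ψ₂ 0) ℓ}
                 {ψ₁ : Ψ₁ ⇒ Ψ} {φ₁ : Ψ₁ ⇒ Φ} {ψ₂ : Ψ₂ ⇒ Ψ₁} {M M' L L'} →
                 (∀ {V W} → R V W → R' V W) →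
                 M [ ψ₁ ] ≡ L [ φ₁ ] → M' [ ψ₁ ] ≡ L' [ φ₁ ] →
                 Coherent R ψ₁ ψ₂ M M' → Coherent R' φ₁ ψ₂ L L'
  Coherent-map {ψ₁ = ψ₁} {φ₁} {ψ₂} {M} {M'} {L} {L'} R⊆R' M≡L M'≡L' c = record
    { M⇓M₁ = subst (_⇓ _) M≡L M⇓M₁ ; M₁⇓M₂ = M₁⇓M₂ ; M⇓M₁₂ = subst (_⇓ _) (composite M L M≡L) M⇓M₁₂
    ; M'⇓M₁' = subst (_⇓ _) M'≡L' M'⇓M₁' ; M₁'⇓M₂' = M₁'⇓M₂'
    ; M'⇓M₁₂' = subst (_⇓ _) (composite M' L' M'≡L') M'⇓M₁₂'
    ; M₂∼M₂' = R⊆R' M₂∼M₂'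
    ; M₂∼M₁₂ = λ i j → R⊆R' (M₂∼M₁₂ i j)
    ; M₂'∼M₁₂' = λ i j → R⊆R' (M₂'∼M₁₂' i j) }
    where
    open Coherent c
    composite : ∀ X Y → X [ ψ₁ ] ≡ Y [ φ₁ ] → X [ ψ₁ ⊙ ψ₂ ] ≡ Y [ φ₁ ⊙ ψ₂ ]
    composite X Y X≡Y = trans ([]-⊙ X ψ₁ ψ₂) (trans (cong (_[ ψ₂ ]) X≡Y) (sym ([]-⊙ Y φ₁ ψ₂)))

  -- Closure properties of `Tm`

  module _ {ℓ Ψ} (α : DRel S ℓ Ψ) where

    Tm-resp : ∀ {Ψ'} {ψ φ : Ψ' ⇒ Ψ} {M L M' L'} → ψ ≡ φ → M ≡ L → M' ≡ L' →
              (Tm α ＠ ψ) M M' → (Tm α ＠ φ) L L'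
    Tm-resp refl refl refl t = t

    Tm-[] : ∀ {Ψ' Ψ''} {ψ : Ψ' ⇒ Ψ} {M M'} → (Tm α ＠ ψ) M M' →
            (χ : Ψ'' ⇒ Ψ') → (Tm α ＠ (ψ ⊙ χ)) (M [ χ ]) (M' [ χ ])
    Tm-[] {ψ = ψ} {M} {M'} t χ ψ₁ ψ₂ = Coherent-map
      (subst (λ ω → (α ＠ (ω ⊙ ψ₂)) _ _) (sym (⊙-assoc ψ χ ψ₁)))
      ([]-⊙ M χ ψ₁) ([]-⊙ M' χ ψ₁) (t (χ ⊙ ψ₁) ψ₂)

    -- Both substitutions are taken to be identities. The values are `M₂` and `M₂'`, since coherence
    -- relates these; each is reached by chaining two evaluations.
    Tm-⇓ : ∀ {Ψ'} {ψ : Ψ' ⇒ Ψ} {M M'} → (Tm α ＠ ψ) M M' →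
           ∃[ V ] ∃[ V' ] M ⇓ V × M' ⇓ V' × (α ＠ ψ) V V'
    Tm-⇓ {Ψ'} {ψ} {M} {M'} t =
      M₂ , M₂' , evaluates M M⇓M₁ M₁⇓M₂ , evaluates M' M'⇓M₁' M₁'⇓M₂' ,
      subst (λ χ → (α ＠ χ) M₂ M₂') (trans (⊙-identityʳ _) (⊙-identityʳ ψ)) M₂∼M₂'
      where
      open Coherent (t idᵈ idᵈ)
      evaluates : ∀ L {L₁ L₂ : Term S Ψ' 0} → L [ idᵈ ] ⇓ L₁ → L₁ [ idᵈ ] ⇓ L₂ → L ⇓ L₂
      evaluates L {L₁} L⇓L₁ L₁⇓L₂ =
        ↦*-⇓ (proj₁ (subst (_⇓ _) ([idᵈ] L) L⇓L₁)) (subst (_⇓ _) ([idᵈ] L₁) L₁⇓L₂)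

  module _ {ℓ Ψ} (α : DRel S ℓ Ψ) (per : IsPER α) where
    private module α {Ψ'} {ψ : Ψ' ⇒ Ψ} = IsPartialEquivalence (per ψ)

    Tm-IsPER : IsPER (Tm α)
    Tm-IsPER ψ = record
      { sym   = λ t ψ₁ ψ₂ → let open Coherent (t ψ₁ ψ₂) in record
        { M⇓M₁ = M'⇓M₁' ; M₁⇓M₂ = M₁'⇓M₂' ; M⇓M₁₂ = M'⇓M₁₂'
        ; M'⇓M₁' = M⇓M₁ ; M₁'⇓M₂' = M₁⇓M₂ ; M'⇓M₁₂' = M⇓M₁₂
        ; M₂∼M₂' = α.sym M₂∼M₂' ; M₂∼M₁₂ = M₂'∼M₁₂' ; M₂'∼M₁₂' = M₂∼M₁₂ }
      ; trans = λ t t' ψ₁ ψ₂ →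
        let module c = Coherent (t ψ₁ ψ₂)
            module d = Coherent (t' ψ₁ ψ₂)
            -- Determinism makes the two evaluations of the middle term agree, first before `ψ₂` and
            -- then after it, so transitivity of `α` applies.
            middle≡ = ⇓-unique d.M₁⇓M₂ (subst (λ X → X [ ψ₂ ] ⇓ c.M₂') (⇓-unique c.M'⇓M₁' d.M⇓M₁) c.M₁'⇓M₂')
        in record
        { M⇓M₁ = c.M⇓M₁ ; M₁⇓M₂ = c.M₁⇓M₂ ; M⇓M₁₂ = c.M⇓M₁₂
        ; M'⇓M₁' = d.M'⇓M₁' ; M₁'⇓M₂' = d.M₁'⇓M₂' ; M'⇓M₁₂' = d.M'⇓M₁₂'
        ; M₂∼M₂' = α.trans c.M₂∼M₂' (subst (λ X → (α ＠ _) X _) middle≡ d.M₂∼M₂')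
        ; M₂∼M₁₂ = c.M₂∼M₁₂ ; M₂'∼M₁₂' = d.M₂'∼M₁₂' } }

    private module Tmα {Ψ'} {ψ : Ψ' ⇒ Ψ} = IsPartialEquivalence (Tm-IsPER ψ)

    -- The reduct `N` is chosen anew for each `χ`, with no compatibility between choices. Coherence
    -- of `M` is borrowed from `M'`: the results of `M` along the two routes are each related to
    -- `M₁₂'`, hence to each other.
    Tm-expansion : ∀ {Ψ'} {ψ : Ψ' ⇒ Ψ} {M M'} →
      (∀ {Ψ''} (χ : Ψ'' ⇒ Ψ') → ∃[ N ] Star _↦_ (M [ χ ]) N × (Tm α ＠ (ψ ⊙ χ)) N (M' [ χ ])) →
      (Tm α ＠ ψ) M M'
    Tm-expansion {ψ = ψ} {M} {M'} step ψ₁ ψ₂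
      with N  , M↦N   , N∼M'  ← step ψ₁
         | N₁ , M↦N₁  , N₁∼M' ← step (ψ₁ ⊙ ψ₂)
      with V , V' , N₁⇓V , M'⇓V' , V∼V' ← Tm-⇓ α N₁∼M'
      = record
      { M⇓M₁ = ↦*-⇓ M↦N (subst (_⇓ _) ([idᵈ] N) c.M⇓M₁)
      ; M₁⇓M₂ = c.M₁⇓M₂
      ; M⇓M₁₂ = ↦*-⇓ M↦N₁ N₁⇓V
      ; M'⇓M₁' = subst (_⇓ _) ([idᵈ] (M' [ ψ₁ ])) c.M'⇓M₁'
      ; M₁'⇓M₂' = c.M₁'⇓M₂'
      ; M'⇓M₁₂' = M'⇓M₁₂'
      ; M₂∼M₂' = reindex c.M₂∼M₂'
      ; M₂∼M₁₂ = ⟪⟫-pair (per _) (α.trans M₂∼M₁₂' (α.sym V∼M₁₂'))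
      ; M₂'∼M₁₂' = λ i j → reindex (c.M₂'∼M₁₂' i j) }
      where
      -- `N∼M'` already lives at `ψ ⊙ ψ₁`, so its first substitution is the identity and only `ψ₂`
      -- remains.
      module c = Coherent (N∼M' idᵈ ψ₂)
      reindex : ∀ {X Y} → (α ＠ (ψ ⊙ ψ₁ ⊙ idᵈ ⊙ ψ₂)) X Y → (α ＠ (ψ ⊙ ψ₁ ⊙ ψ₂)) X Y
      reindex = subst (λ ω → (α ＠ (ω ⊙ ψ₂)) _ _) (⊙-identityʳ (ψ ⊙ ψ₁))
      M'⇓M₁₂' : M' [ ψ₁ ⊙ ψ₂ ] ⇓ c.M₁₂'
      M'⇓M₁₂' = subst (_⇓ _)
        (trans (cong (M' [ ψ₁ ] [_]) (⊙-identityˡ ψ₂)) (sym ([]-⊙ M' ψ₁ ψ₂))) c.M'⇓M₁₂'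
      M₂∼M₁₂' : (α ＠ (ψ ⊙ ψ₁ ⊙ ψ₂)) c.M₂ c.M₁₂'
      M₂∼M₁₂' = α.trans (reindex c.M₂∼M₂') (reindex (c.M₂'∼M₁₂' zero (suc zero)))
      V∼M₁₂' : (α ＠ (ψ ⊙ ψ₁ ⊙ ψ₂)) V c.M₁₂'
      -- `V'` and `c.M₁₂'` are both values of `M' [ ψ₁ ⊙ ψ₂ ]`, hence equal.
      V∼M₁₂' = subst (λ ω → (α ＠ ω) V c.M₁₂') (sym (⊙-assoc ψ ψ₁ ψ₂))
        (subst ((α ＠ _) V) (⇓-unique M'⇓V' M'⇓M₁₂') V∼V')

    -- Composition data and single compositions

    module _ {Ψ' n} {ψ : Ψ' ⇒ Ψ} {r : Dim Ψ'} {ξs : Vec (Constraint Ψ') n}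
             {M M' : Term S Ψ' 0} {Ns Ns' : Vec (Term S (suc Ψ') 0) n}
             (d : CompositionData α ψ r ξs M M' Ns Ns') where
      open CompositionData d

      tube-⟨/y⟩ : ∀ i j (s : Dim Ψ') {Ψ''} (χ : Ψ'' ⇒ Ψ') → ⊨ lookup ξs i [ χ ]ᶜ → ⊨ lookup ξs j [ χ ]ᶜ →
                  (Tm α ＠ (ψ ⊙ χ)) (lookup Ns i [ ⟨ s /y⟩ ] [ χ ]) (lookup Ns' j [ ⟨ s /y⟩ ] [ χ ])
      tube-⟨/y⟩ i j s χ p q = Tm-resp α (cong (ψ ⊙_) forget) ([]-⊙ (lookup Ns i) _ _) ([]-⊙ (lookup Ns' j) _ _)
        (tube i j (⟨ s /y⟩ ⊙ χ) (weaken (lookup ξs i) p ∷ weaken (lookup ξs j) q ∷ []))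
        where
        forget : π ⊙ (⟨ s /y⟩ ⊙ χ) ≡ χ
        forget = trans (π-⊙-∷ (s [ χ ]ᵈ) (idᵈ ⊙ χ)) (⊙-identityˡ χ)
        weaken : ∀ ξ → ⊨ ξ [ χ ]ᶜ → ⊨ ξ [ π ]ᶜ [ ⟨ s /y⟩ ⊙ χ ]ᶜ
        weaken ξ = subst ⊨_ (trans (cong (ξ [_]ᶜ) (sym forget)) ([]ᶜ-⊙ ξ π (⟨ s /y⟩ ⊙ χ)))

      -- Allows facts about the left composition to be used for the right one. Adjacency follows
      -- from the chain N'ᵢ⟨r/y⟩ ∼ Nᵢ⟨r/y⟩ ∼ M ∼ M'.
      CompositionData-sym : CompositionData α ψ r ξs M' M Ns' Ns
      CompositionData-sym = record
        { valid = valid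
        ; cap   = Tmα.sym cap
        ; tube  = λ { i j χ (p ∷ q ∷ []) → Tmα.sym (tube j i χ (q ∷ p ∷ [])) }
        ; adj   = λ { i χ (p ∷ []) →
            Tmα.trans (Tmα.sym (tube-⟨/y⟩ i i r χ p p)) (Tmα.trans (adj i χ (p ∷ [])) (Tm-[] α cap χ)) } }

      CompositionData-reflˡ : CompositionData α ψ r ξs M M Ns Ns
      CompositionData-reflˡ = record
        { valid = valid
        ; cap   = Tmα.trans cap (Tmα.sym cap)
        ; tube  = λ { i j χ (p ∷ q ∷ []) →
            -- Nᵢ and Nⱼ are compared through N'ⱼ, which is related to both where ξᵢ and ξⱼ hold.
            Tmα.trans (tube i j χ (p ∷ q ∷ [])) (Tmα.sym (tube j j χ (q ∷ q ∷ []))) }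
        ; adj   = adj }

      -- Reduces a claim about all instances of a composition to a claim about the composition
      -- itself, for arbitrary data.
      CompositionData-[] : ∀ {Ψ''} (χ : Ψ'' ⇒ Ψ') →
        CompositionData α (ψ ⊙ χ) (r [ χ ]ᵈ) (Vec.map (_[ χ ]ᶜ) ξs) (M [ χ ]) (M' [ χ ])
          (dsubs Ns (liftᵈ 1 χ)) (dsubs Ns' (liftᵈ 1 χ))
      CompositionData-[] χ = record
        { valid = Valid-[]ᶜ χ valid
        ; cap   = Tm-[] α cap χ
        ; tube  = λ { i j ω (p ∷ q ∷ []) →
            Tm-resp α (trans (cong (ψ ⊙_) (π-⊙-liftᵈ χ ω)) (sym (⊙-assoc ψ χ (π ⊙ ω))))
              (lookup-dsubs-⊙ Ns i ω) (lookup-dsubs-⊙ Ns' j ω)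
              (tube i j (liftᵈ 1 χ ⊙ ω) (unsubstitute i ω p ∷ unsubstitute j ω q ∷ [])) }
        ; adj   = λ { i ω (p ∷ []) →
            Tm-resp α (sym (⊙-assoc ψ χ ω))
              (trans ([]-⊙ (lookup Ns i [ ⟨ r /y⟩ ]) χ ω) (cong (_[ ω ]) (sym (lookup-dsubs-⟨/y⟩ Ns r χ i))))
              ([]-⊙ M χ ω)
              (adj i (χ ⊙ ω) (subst ⊨_ (sym ([]ᶜ-⊙ (lookup ξs i) χ ω))
                (subst (λ ξ → ⊨ ξ [ ω ]ᶜ) (lookup-map i (_[ χ ]ᶜ) ξs) p) ∷ [])) } }
        where
        lookup-dsubs-⊙ : ∀ (Ks : Vec (Term S (suc Ψ') 0) n) i {Ψ₃} (ω : Ψ₃ ⇒ _) →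
                         lookup Ks i [ liftᵈ 1 χ ⊙ ω ] ≡ lookup (dsubs Ks (liftᵈ 1 χ)) i [ ω ]
        lookup-dsubs-⊙ Ks i ω =
          trans ([]-⊙ (lookup Ks i) (liftᵈ 1 χ) ω) (cong (_[ ω ]) (sym (lookup-dsubs Ks (liftᵈ 1 χ) i)))
        unsubstitute : ∀ i {Ψ₃} (ω : Ψ₃ ⇒ suc _) → ⊨ lookup (Vec.map (_[ χ ]ᶜ) ξs) i [ π ]ᶜ [ ω ]ᶜ →
                       ⊨ lookup ξs i [ π ]ᶜ [ liftᵈ 1 χ ⊙ ω ]ᶜ
        unsubstitute i ω = subst ⊨_ (begin
          lookup (Vec.map (_[ χ ]ᶜ) ξs) i [ π ]ᶜ [ ω ]ᶜ  ≡⟨ cong (λ ξ → ξ [ π ]ᶜ [ ω ]ᶜ) (lookup-map i (_[ χ ]ᶜ) ξs) ⟩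
          ξ [ χ ]ᶜ [ π ]ᶜ [ ω ]ᶜ                         ≡⟨ []ᶜ-⊙ (ξ [ χ ]ᶜ) π ω ⟨
          ξ [ χ ]ᶜ [ π ⊙ ω ]ᶜ                            ≡⟨ []ᶜ-⊙ ξ χ (π ⊙ ω) ⟨
          ξ [ χ ⊙ (π ⊙ ω) ]ᶜ                             ≡⟨ cong (ξ [_]ᶜ) (π-⊙-liftᵈ χ ω) ⟨
          ξ [ π ⊙ (liftᵈ 1 χ ⊙ ω) ]ᶜ                     ≡⟨ []ᶜ-⊙ ξ π (liftᵈ 1 χ ⊙ ω) ⟩
          ξ [ π ]ᶜ [ liftᵈ 1 χ ⊙ ω ]ᶜ                    ∎)
          where
          open ≡-Reasoning
          ξ = lookup ξs i

      -- A true ξᵢ stays true under `χ`, but the least true constraint ξⱼ may lie before it, so the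
      -- reduct is Nⱼ and must be compared with Nᵢ.
      fhcom-∼-tube : ∀ {r'} i → ⊨ lookup ξs i → (Tm α ＠ ψ) (fhcom r r' M ξs Ns) (lookup Ns i [ ⟨ r' /y⟩ ])
      fhcom-∼-tube {r'} i ξᵢ = Tm-expansion step
        where
        step : ∀ {Ψ''} (χ : Ψ'' ⇒ Ψ') →
               ∃[ N ] Star _↦_ (fhcom r r' M ξs Ns [ χ ]) N × (Tm α ＠ (ψ ⊙ χ)) N (lookup Ns i [ ⟨ r' /y⟩ ] [ χ ])
        step χ with leastTrue (Vec.map (_[ χ ]ᶜ) ξs)
        ... | inj₂ none          = contradiction (⊨-lookup-map⁺ ξs χ i (⊨-[]ᶜ (lookup ξs i) χ ξᵢ)) (none i)
        ... | inj₁ (j , ξⱼ , least) =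
          _ , fhcom-tube j ξⱼ least ◅ ε , Tm-resp α refl (sym (lookup-dsubs-⟨/y⟩ Ns r' χ j)) refl
            -- The hypotheses relate unprimed tubes to primed ones, so the comparison goes through
            -- N'ᵢ.
            (Tmα.trans (tube-⟨/y⟩ j i r' χ ⊨ⱼ ⊨ᵢ) (Tmα.sym (tube-⟨/y⟩ i i r' χ ⊨ᵢ ⊨ᵢ)))
          where
          ⊨ᵢ = ⊨-[]ᶜ (lookup ξs i) χ ξᵢ
          ⊨ⱼ = ⊨-lookup-map⁻ ξs χ j ξⱼ

      -- With equal end dimensions an active tube yields Nⱼ⟨r/y⟩, which is exactly the face that
      -- adjacency relates to `M`.
      fhcom-∼-cap : (Tm α ＠ ψ) (fhcom r r M ξs Ns) M
      fhcom-∼-cap = Tm-expansion step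
        where
        step : ∀ {Ψ''} (χ : Ψ'' ⇒ Ψ') →
               ∃[ N ] Star _↦_ (fhcom r r M ξs Ns [ χ ]) N × (Tm α ＠ (ψ ⊙ χ)) N (M [ χ ])
        step χ with leastTrue (Vec.map (_[ χ ]ᶜ) ξs)
        ... | inj₂ none             =
          _ , fhcom-cap none refl ◅ ε , Tm-[] α (Tmα.trans cap (Tmα.sym cap)) χ
        ... | inj₁ (j , ξⱼ , least) =
          _ , fhcom-tube j ξⱼ least ◅ ε , Tm-resp α refl (sym (lookup-dsubs-⟨/y⟩ Ns r χ j)) refl
            (adj j χ (⊨-lookup-map⁻ ξs χ j ξⱼ ∷ []))

    -- Comparison of two compositions

    module _ {Ψ' n} {ψ : Ψ' ⇒ Ψ} {r r' : Dim Ψ'} {ξs : Vec (Constraint Ψ') n}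
             {M M' : Term S Ψ' 0} {Ns Ns' : Vec (Term S (suc Ψ') 0) n}
             (d : CompositionData α ψ r ξs M M' Ns Ns') where
      open CompositionData d

      -- Both compositions have the same constraints and dimensions, so they step by the same rule
      -- or are values together.
      fhcom-∼-or-value : (Tm α ＠ ψ) (fhcom r r' M ξs Ns) (fhcom r r' M' ξs Ns')
                         ⊎ ((∀ i → ¬ (⊨ lookup ξs i)) × r ≢ r')
      fhcom-∼-or-value with leastTrue ξs
      ... | inj₁ (i , ξᵢ , _) = inj₁ (Tmα.trans (fhcom-∼-tube d i ξᵢ)
              (Tmα.trans tubes (Tmα.sym (fhcom-∼-tube (CompositionData-sym d) i ξᵢ))))
        where
        tubes : (Tm α ＠ ψ) (lookup Ns i [ ⟨ r' /y⟩ ]) (lookup Ns' i [ ⟨ r' /y⟩ ])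
        tubes = Tm-resp α (⊙-identityʳ ψ) ([idᵈ] _) ([idᵈ] _)
          (tube-⟨/y⟩ d i i r' idᵈ (⊨-[]ᶜ (lookup ξs i) idᵈ ξᵢ) (⊨-[]ᶜ (lookup ξs i) idᵈ ξᵢ))
      ... | inj₂ none with r ≟ᵈ r'
      ...   | yes refl = inj₁ (Tmα.trans (fhcom-∼-cap d)
                (Tmα.trans cap (Tmα.sym (fhcom-∼-cap (CompositionData-sym d)))))
      ...   | no  r≢r' = inj₂ (none , r≢r')

      Fhcom-∼ : (∀ i → ¬ (⊨ lookup ξs i)) → r ≢ r' →
                (Fhcom α ＠ ψ) (fhcom r r' M ξs Ns) (fhcom r r' M' ξs Ns')
      Fhcom-∼ no-ξ r≢r' = record
        { V≡ = refl ; V'≡ = refl ; no-ξ = no-ξ ; r≢r' = r≢r' ; data-ok = d }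

    -- Each summand is treated separately: `α` as a PER, `Fhcom α` by comparing each composition
    -- with itself.
    ∪-Fhcom-refl : ∀ {Ψ'} {ψ : Ψ' ⇒ Ψ} {V V'} → ((α ∪ Fhcom α) ＠ ψ) V V' →
                   ((α ∪ Fhcom α) ＠ ψ) V V × ((α ∪ Fhcom α) ＠ ψ) V' V'
    ∪-Fhcom-refl (inj₁ v) = inj₁ (α.trans v (α.sym v)) , inj₁ (α.trans (α.sym v) v)
    ∪-Fhcom-refl (inj₂ record { V≡ = refl ; V'≡ = refl ; no-ξ = no-ξ ; r≢r' = r≢r' ; data-ok = d }) =
      inj₂ (Fhcom-∼ (CompositionData-reflˡ d) no-ξ r≢r') ,
      inj₂ (Fhcom-∼ (CompositionData-reflˡ (CompositionData-sym d)) no-ξ r≢r')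

    -- Applied after the second substitution, which may turn a composition that was a value into one
    -- that steps; the result may thus land in either summand.
    fhcom-⇓ : ∀ {Ψ' n} {ψ : Ψ' ⇒ Ψ} {r r' : Dim Ψ'} {ξs : Vec (Constraint Ψ') n} {M M' Ns Ns'} →
      CompositionData α ψ r ξs M M' Ns Ns' →
      ∃[ V ] ∃[ V' ] fhcom r r' M ξs Ns ⇓ V × fhcom r r' M' ξs Ns' ⇓ V' × ((α ∪ Fhcom α) ＠ ψ) V V'
    fhcom-⇓ {r' = r'} d with fhcom-∼-or-value {r' = r'} d
    ... | inj₁ t with V , V' , ⇓V , ⇓V' , v ← Tm-⇓ α t = V , V' , ⇓V , ⇓V' , inj₁ v
    ... | inj₂ (no-ξ , r≢r') = _ , _ , Val-⇓ (fhcom-Val no-ξ r≢r') , Val-⇓ (fhcom-Val no-ξ r≢r') ,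
                               inj₂ (Fhcom-∼ d no-ξ r≢r')

    fhcom-∼ : ∀ {Ψ' n} {ψ : Ψ' ⇒ Ψ} {r r' : Dim Ψ'} {ξs : Vec (Constraint Ψ') n} {M M' Ns Ns'} →
      CompositionData α ψ r ξs M M' Ns Ns' →
      (Tm (α ∪ Fhcom α) ＠ ψ) (fhcom r r' M ξs Ns) (fhcom r r' M' ξs Ns')
    fhcom-∼ {ψ = ψ} {r} {r'} {ξs} {M} {M'} {Ns} {Ns'} d ψ₁ ψ₂
      with fhcom-∼-or-value {r' = r' [ ψ₁ ]ᵈ} (CompositionData-[] d ψ₁)
    -- `t` is a fact about the instances at `ψ₁`, so it is used with `idᵈ` and `ψ₂`.
    ... | inj₁ t = Coherent-map
            (λ v → inj₁ (subst (λ ω → (α ＠ (ω ⊙ ψ₂)) _ _) (⊙-identityʳ (ψ ⊙ ψ₁)) v))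
            ([idᵈ] (fhcom r r' M ξs Ns [ ψ₁ ])) ([idᵈ] (fhcom r r' M' ξs Ns' [ ψ₁ ])) (t idᵈ ψ₂)
    ... | inj₂ (no-ξ , r≢r')
      with V , V' , ⇓V , ⇓V' , v ← fhcom-⇓ {r' = r' [ ψ₁ ]ᵈ [ ψ₂ ]ᵈ} (CompositionData-[] (CompositionData-[] d ψ₁) ψ₂)
      -- `M₁` is the composition at `ψ₁` itself; by functoriality both routes then evaluate the same
      -- term, so `M₂` and `M₁₂` are both `V`.
      = record
      { M⇓M₁ = Val-⇓ (fhcom-Val no-ξ r≢r')
      ; M₁⇓M₂ = ⇓V
      ; M⇓M₁₂ = subst (_⇓ V) (sym ([]-⊙ (fhcom r r' M ξs Ns) ψ₁ ψ₂)) ⇓V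
      ; M'⇓M₁' = Val-⇓ (fhcom-Val no-ξ r≢r')
      ; M₁'⇓M₂' = ⇓V'
      ; M'⇓M₁₂' = subst (_⇓ V') (sym ([]-⊙ (fhcom r r' M' ξs Ns') ψ₁ ψ₂)) ⇓V'
      ; M₂∼M₂' = v
      ; M₂∼M₁₂ = ⟪⟫-diagonal ((α ∪ Fhcom α) ＠ _) (proj₁ (∪-Fhcom-refl v))
      ; M₂'∼M₁₂' = ⟪⟫-diagonal ((α ∪ Fhcom α) ＠ _) (proj₂ (∪-Fhcom-refl v)) }

    -- Equations under constraints, and the theorem

    fhcom-∼-tube∣ : ∀ {Ψ' n} {ψ : Ψ' ⇒ Ψ} {r r' : Dim Ψ'} {ξs : Vec (Constraint Ψ') n} {M M' Ns Ns'} →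
      CompositionData α ψ r ξs M M' Ns Ns' →
      ∀ i → (Tm α ＠ ψ ∣ (lookup ξs i ∷ [])) (fhcom r r' M ξs Ns) (lookup Ns i [ ⟨ r' /y⟩ ])
    fhcom-∼-tube∣ {r' = r'} {ξs} {Ns = Ns} d i χ (ξᵢ ∷ []) =
      Tm-resp α refl refl (lookup-dsubs-⟨/y⟩ Ns r' χ i)
        (fhcom-∼-tube (CompositionData-[] d χ) i (⊨-lookup-map⁺ ξs χ i ξᵢ))

    fhcom-∼-cap∣ : ∀ {Ψ' n} {ψ : Ψ' ⇒ Ψ} {r r' : Dim Ψ'} {ξs : Vec (Constraint Ψ') n} {M M' Ns Ns'} →
      CompositionData α ψ r ξs M M' Ns Ns' →
      (Tm α ＠ ψ ∣ ((r ＝ r') ∷ [])) (fhcom r r' M ξs Ns) M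
    fhcom-∼-cap∣ {ψ = ψ} {ξs = ξs} {M} {Ns = Ns} d χ (r≡r' ∷ []) =
      -- Where the constraint holds, the end dimension may be replaced by the start dimension, the
      -- form `fhcom-∼-cap` requires.
      subst (λ s → (Tm α ＠ (ψ ⊙ χ)) (fhcom _ s (M [ χ ]) (Vec.map (_[ χ ]ᶜ) ξs) (dsubs Ns (liftᵈ 1 χ))) (M [ χ ]))
        r≡r' (fhcom-∼-cap (CompositionData-[] d χ))

lemma4p13 : {ℓ ℓ' κ : Level} {S : Signature} (O : OpSem S) →
    let open Semantics O in
    (T : CubicalTypeSystem ℓ ℓ') →
    let open TypeTheory T in
    {Ψ n : ℕ} (Δ : Tele Ψ n) → Δ ctxKan →
    (α : IndexedRel κ Δ) → IsValueᴵ α → IsPERᴵ α →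
    {Ψ' : ℕ} (ψ : Ψ' ⇒ Ψ) (I : Vec (Term S Ψ' 0) n) (I∈ : I ∈ᵗ Δ [ ψ ]ᵗ)
    (r r' : Dim Ψ') {k : ℕ} (ξs : Vec (Constraint Ψ') k) → Valid ξs →
    {M M' : Term S Ψ' 0} {Ns Ns' : Vec (Term S (suc Ψ') 0) k} →
    (Tm (at α ψ I I∈) ＠ idᵈ) M M' →
    (∀ i j → (Tm (at α ψ I I∈) ＠y∣ (lookup ξs i ∷ lookup ξs j ∷ [])) (lookup Ns i) (lookup Ns' j)) →
    (∀ i → (Tm (at α ψ I I∈) ＠ idᵈ ∣ (lookup ξs i ∷ [])) (lookup Ns i [ ⟨ r /y⟩ ]) M) →
    (∀ i → (Tm (at α ψ I I∈) ＠ idᵈ ∣ (lookup ξs i ∷ [])) (fhcom r r' M ξs Ns) (lookup Ns i [ ⟨ r' /y⟩ ]))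
    × (Tm (at α ψ I I∈) ＠ idᵈ ∣ ((r ＝ r') ∷ [])) (fhcom r r' M ξs Ns) M
    × (Tm (at (α ∪ᴵ Fhcomᴵ α) ψ I I∈) ＠ idᵈ) (fhcom r r' M ξs Ns) (fhcom r r' M' ξs Ns')
lemma4p13 O T Δ _ α _ per ψ I I∈ r r' ξs valid cap tube adj =
  -- The component of `α ∪ᴵ Fhcomᴵ α` at `ψ`, `I` unfolds to `β ∪ Fhcom β`, so the whole argument
  -- concerns the single relation `β`.
  fhcom-∼-tube∣ O β β-per d , fhcom-∼-cap∣ O β β-per d , fhcom-∼ O β β-per d
  where
  open Semantics O
  open TypeTheory T
  β = at α ψ I I∈
  β-per : IsPER β
  β-per = per ψ I I∈
  d = record
    { valid = valid
    ; cap   = cap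
    -- The hypothesis is indexed by `π ⊙ χ`, the record field by `idᵈ ⊙ (π ⊙ χ)`.
    ; tube  = λ i j χ p → Tm-resp O β (sym (⊙-identityˡ (π ⊙ χ))) refl refl (tube i j χ p)
    ; adj   = adj }
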